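{- There is a randomized algorithm which takes as input parameters $k\in\mathbb{N}$ and $\epsilon>0$ and has query (oracle) access to an arbitrary function $f:\{ -1,1\}^n\to\{ -1,1\}$, makes $\mathrm{poly}(k,1/\epsilon)$ queries to $f$, and with probability at least $2/3$ outputs a number $\widehat{\mathsf{Corr}}_{f,\mathsf{gap},k}$ satisfying \[ \max_{g\in\mathcal{J}_{n,k}} \mathbf{E}_{\mathbf{x}}[g(\mathbf{x})f(\mathbf{x})] - \epsilon \le \widehat{\mathsf{Corr}}_{f,\mathsf{gap},k} \le \max_{g\in\mathcal{J}_{n,k^2/\epsilon^2}} \mathbf{E}_{\mathbf{x}}[g(\mathbf{x})f(\mathbf{x})] + \epsilon. \]
   Context: A function $g:\{ -1,1\}^n\to\{ -1,1\}$ is a $k$-junta if there is a set of at most $k$ coordinates such that $g(x)$ depends only on the values of $x$ on those coordinates. $\mathcal{J}_{n,m}$ denotes the class of $m$-juntas on $n$ variables (for non-integer $m$, juntas on at most $m$ coordinates). All expectations are over $\mathbf{x}$ uniform on $\{ -1,1\}^n$. Query complexity is the number of evaluations of $f$.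
   Formalization: The accuracy parameter ε > 0 ranges over positive rational numbers rather than positive real numbers. -}

module Defs where

open import Data.Bool using (Bool; true; false; if_then_else_)
open import Data.Bool.Properties using () renaming (_≟_ to _≟ᵇ_)
open import Data.Nat as ℕ using (ℕ; zero; suc; _⊔_)
import Data.Integer as ℤ
open import Data.Rational using (ℚ; 0ℚ; 1ℚ; ½; _+_; _-_; _*_; _≤_; _/_; -_; 1/_; Positive; ceiling)
open import Data.Rational.Properties using (pos⇒nonZero)
open import Data.Vec using (Vec; []; _∷_; lookup)
open import Data.Fin using (Fin)
open import Data.Fin.Subset using (Subset; _∈_; ∣_∣)
open import Data.Product using (Σ; ∃; _×_; _,_)
open import Relation.Binary.PropositionalEquality using (_≡_)
open import Relation.Nullary using (yes; no)

-- The Boolean cube {-1,1}^n; a coordinate value is encoded by a Bool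
-- (the encoding of ±1 by Bool is irrelevant: only agreement matters).
Cube : ℕ → Set
Cube n = Vec Bool n

ℕ→ℚ : ℕ → ℚ
ℕ→ℚ m = ℤ.+ m / 1

BoolFn : ℕ → Set
BoolFn n = Cube n → Bool

sgnProd : Bool → Bool → ℚ
sgnProd a b with a ≟ᵇ b
... | yes _ = 1ℚ
... | no  _ = - 1ℚ

E : (n : ℕ) → (Cube n → ℚ) → ℚ
E zero h = h []
E (suc n) h = ½ * (E n (λ x → h (true ∷ x)) + E n (λ x → h (false ∷ x)))

corr : (n : ℕ) → BoolFn n → BoolFn n → ℚ
corr n g f = E n (λ x → sgnProd (g x) (f x))

AgreeOn : {n : ℕ} → Subset n → Cube n → Cube n → Set
AgreeOn {n} S x y = (i : Fin n) → i ∈ S → lookup x i ≡ lookup y i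

IsJunta : (n : ℕ) → ℚ → BoolFn n → Set
IsJunta n m g = Σ (Subset n) λ S →
  (ℕ→ℚ ∣ S ∣ ≤ m) × ((x y : Cube n) → AgreeOn S x y → g x ≡ g y)

k²/ε² : ℕ → (ε : ℚ) → .{{Positive ε}} → ℚ
k²/ε² k ε {{p}} = let r = ℕ→ℚ k * (1/ ε) {{pos⇒nonZero ε {{p}}}} in r * r

-- The output q satisfies
--   max_{g ∈ J_{n,k}} E[gf] - ε ≤ q ≤ max_{g ∈ J_{n,k²/ε²}} E[gf] + ε.
-- Since J_{n,m} is finite and nonempty, the two inequalities about the
-- maxima are written out as: every k-junta g has E[gf] - ε ≤ q, and some
-- (k²/ε²)-junta g has q ≤ E[gf] + ε.
GoodEstimate : (n k : ℕ) (ε : ℚ) → .{{Positive ε}} → BoolFn n → ℚ → Set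
GoodEstimate n k ε f q =
  ((g : BoolFn n) → IsJunta n (ℕ→ℚ k) g → corr n g f - ε ≤ q)
  × (∃ λ g → IsJunta n (k²/ε² k ε) g × (q ≤ corr n g f + ε))

-- Randomized query algorithms with oracle access to f : {-1,1}^n → {-1,1},
-- as finite trees: output a number, query f at a point, or flip a fair coin.
data Alg (n : ℕ) : Set where
  out  : ℚ → Alg n
  ask  : Cube n → (Bool → Alg n) → Alg n
  coin : (Bool → Alg n) → Alg n

queries : {n : ℕ} → Alg n → ℕ
queries (out _)  = 0
queries (ask _ k) = suc (queries (k true) ⊔ queries (k false))
queries (coin k) = queries (k true) ⊔ queries (k false)

-- PrAtLeast f P A p : running A with oracle f, the probability (over the
-- fair coins) that the output satisfies P is at least p.
data PrAtLeast {n : ℕ} (f : BoolFn n) (P : ℚ → Set) : Alg n → ℚ → Set where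
  triv : ∀ {A p} → p ≤ 0ℚ → PrAtLeast f P A p
  hit  : ∀ {q p} → P q → p ≤ 1ℚ → PrAtLeast f P (out q) p
  ask  : ∀ {x k p} → PrAtLeast f P (k (f x)) p → PrAtLeast f P (ask x k) p
  coin : ∀ {k a b p} → PrAtLeast f P (k true) a → PrAtLeast f P (k false) b →
         p ≤ ½ * (a + b) → PrAtLeast f P (coin k) p

-- the algorithm: inputs n (implicit in the oracle's domain), k, ε
Algorithm : Set
Algorithm = (n k : ℕ) → ℚ → Alg n

PolyQueries : Algorithm → Set
PolyQueries A = Σ ℕ λ c → Σ ℕ λ d →
  (n k : ℕ) (ε : ℚ) .{{p : Positive ε}} →
  queries (A n k ε) ℕ.≤ c ℕ.* (suc k ℕ.* ℤ.∣ ceiling ((1/ ε) {{pos⇒nonZero ε {{p}}}}) ∣) ℕ.^ d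

twoThirds : ℚ
twoThirds = ℤ.+ 2 / 3

{-# OPTIONS --safe #-}

-- Let F be f as a ±1-valued function, E|F_A| the mean of |E[F | x_A]|, and W(A) the mean of its square, which is the
-- Fourier mass of F on subsets of A. The best correlation of f with a junta on A is E|F_A|. Let w_i be the mass on sets
-- U ∋ i with U discounted by ρ^|U|, where 1 - ρ is of order 1/k; then Σ w_i = O(k), so the set B of coordinates with
-- w_i ≥ τ ~ ε²/k has at most k²/ε² elements.
--
-- Hash the coordinates into poly(k, 1/ε) buckets, estimate the analogous influence of every bucket by sampling, let
-- H be the union of the buckets with a large estimate, and output an estimate of E|F_H| plus 13ε/16.
-- Lower bound: a k-set T loses only coordinates of small w_i on passing to T ∩ H, so W(T) - W(T ∩ H) ≤ 3ε², and
-- E|F_T| ≤ E|F_H| + 7ε/4 by Cauchy-Schwarz.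
-- Upper bound: few heavy collisions occur, so every selected bucket meets B and H lies in the union G of the buckets
-- that meet B. A coordinate outside B lands in G with probability at most |B|/#buckets, so W(G) - W(B) is small and
-- E|F_H| ≤ E|F_G| ≤ E|F_B| + ε/8; the sign of F_B is the required (k²/ε²)-junta.
--
-- All failure events are controlled by one nonnegative score of mean at most 1/3 which is at least 1 on failure.
module Submission where

open import Defs
open import Data.Bool using (Bool; true; false; _∧_; _∨_; not; if_then_else_)
open import Data.Empty using (⊥-elim)
open import Data.Fin using (Fin; zero; suc)
open import Data.Fin.Subset using (Subset) renaming (∣_∣ to card)
import Data.Integer as ℤ
import Data.Integer.DivMod as ℤₚ
import Data.Integer.Properties as ℤₚ
open import Data.Nat as ℕ using (ℕ; zero; suc)
import Data.Nat.Properties as ℕₚ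
open import Data.Nat.Tactic.RingSolver using (solve-∀)
open import Data.Product using (Σ; ∃; _×_; _,_; proj₁; proj₂)
open import Data.Rational using (ℚ; mkℚ; 0ℚ; 1ℚ; ½; _+_; _-_; _*_; _≤_; _<_; -_; _/_; 1/_; ∣_∣;
  floor; ceiling; ↥_; ↧_; toℚᵘ; nonNegative; Positive; positive)
open import Data.Rational.Properties
open import Data.Rational.Solver using (module +-*-Solver)
import Data.Rational.Unnormalised as ℚᵘ
import Data.Rational.Unnormalised.Properties as ℚᵘₚ
open import Data.Sum using (inj₁; inj₂)
open import Data.Vec using (Vec; []; _∷_; lookup; map; here; there; zipWith; tabulate)
open import Data.Vec.Properties using (lookup-map; lookup∘tabulate; map-cong; lookup-zipWith)
open import Relation.Binary.PropositionalEquality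
open import Relation.Nullary using (yes; no)
open +-*-Solver using (solve; _:=_; _:+_; _:*_; _:-_; :-_; con)

-- Two demands shape the proof: the query count may not depend on `n`, and the bound k²/ε² leaves no
-- room for a constant. For the first, influences are measured per bucket, and collisions are
-- weighted by w_i w_j. Their expected total is at most (Σ w_i)² divided by the number of buckets,
-- whatever `n` is: the hash need not separate all coordinates, only keep many light ones from
-- adding up to a bucket that looks heavy. The discount keeps Σ w_i from growing with `n`, while a
-- set of at most k coordinates loses only a factor ρ^k ≥ 1/2. For the second, once Σ w_i is bounded
-- by D, the size of B dictates τ = Dε²/k². The loss in W(T) is then of order ε² with a constant
-- above 1, so the best correlation may drop by more than ε. This is affordable because the two
-- error margins together allow 2ε and the upper bound uses only a small part of it: the shift of
-- the output moves the surplus to the lower side. Square roots and characters never appear: norms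
-- are compared through squares, and Fourier mass is defined by recursion on `n`.

¼ 1/12 1/32 1/16 1/8 13/16 17/16 35/32 9/8 7/4 2ℚ 3ℚ 4ℚ : ℚ
¼     = ½ * ½
1/12  = ℤ.+ 1 / 12
1/32  = ℤ.+ 1 / 32
1/16  = ℤ.+ 1 / 16
1/8   = ℤ.+ 1 / 8
13/16 = ℤ.+ 13 / 16
17/16 = ℤ.+ 17 / 16
35/32 = ℤ.+ 35 / 32
9/8   = ℤ.+ 9 / 8
7/4   = ℤ.+ 7 / 4
2ℚ    = 1ℚ + 1ℚ
3ℚ    = ℤ.+ 3 / 1
4ℚ    = ℤ.+ 4 / 1

-- Inequalities between rationals

≤-by : ∀ {a b} c → 0ℚ ≤ c → b ≡ a + c → a ≤ b
≤-by {a} {b} c 0≤c b≡ = subst (_≤ b) (+-identityʳ a) (subst (a + 0ℚ ≤_) (sym b≡) (+-monoʳ-≤ a 0≤c))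

0≤-diff : ∀ {a b} → a ≤ b → 0ℚ ≤ b - a
0≤-diff {a} {b} a≤b = subst (_≤ b - a) (+-inverseʳ a) (+-monoˡ-≤ (- a) a≤b)

≤-from-diff : ∀ {a b} → 0ℚ ≤ b - a → a ≤ b
≤-from-diff {a} {b} h = ≤-by (b - a) h (solve 2 (λ a b → b := a :+ (b :- a)) refl a b)

0≤+ : ∀ {a b} → 0ℚ ≤ a → 0ℚ ≤ b → 0ℚ ≤ a + b
0≤+ = +-mono-≤

*-mono-nonNeg : ∀ {a b} c → 0ℚ ≤ c → a ≤ b → c * a ≤ c * b
*-mono-nonNeg c 0≤c = *-monoˡ-≤-nonNeg c {{nonNegative 0≤c}}

0≤* : ∀ {a b} → 0ℚ ≤ a → 0ℚ ≤ b → 0ℚ ≤ a * b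
0≤* {a} {b} 0≤a 0≤b = subst (_≤ a * b) (*-zeroʳ a) (*-mono-nonNeg a 0≤a 0≤b)

0≤sq : ∀ a → 0ℚ ≤ a * a
0≤sq a with ≤-total 0ℚ a
... | inj₁ 0≤a = 0≤* 0≤a 0≤a
... | inj₂ a≤0 = subst (0ℚ ≤_) (solve 1 (λ a → (:- a) :* (:- a) := a :* a) refl a)
                   (0≤* (neg-antimono-≤ a≤0) (neg-antimono-≤ a≤0))

*-mono₂ : ∀ {a b c d} → 0ℚ ≤ a → 0ℚ ≤ d → a ≤ b → c ≤ d → a * c ≤ b * d
*-mono₂ {a} {b} {c} {d} 0≤a 0≤d a≤b c≤d = ≤-trans (*-mono-nonNeg a 0≤a c≤d)
  (*-monoʳ-≤-nonNeg d {{nonNegative 0≤d}} a≤b)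

0≤½ : 0ℚ ≤ ½
0≤½ = nonNegative⁻¹ ½

-- Finite positive measures

-- A syntax rather than a class of functionals, so that linearity, monotonicity and Fubini are
-- inductions. Expectations, sums over coordinates (`fins`) and Fourier mass (`spec`) are all
-- instances, and every exchange between them is `∫-swap`. The proof stored in `scale` is what makes
-- `∫` monotone.
data Meas : Set → Set₁ where
  ∅     : ∀ {X} → Meas X
  δ     : ∀ {X} → X → Meas X
  _⊕_   : ∀ {X} → Meas X → Meas X → Meas X
  scale : ∀ {X} (a : ℚ) → 0ℚ ≤ a → Meas X → Meas X
  _>>=_ : ∀ {X Y} → Meas X → (X → Meas Y) → Meas Y

infixl 1 _>>=_
infixl 6 _⊕_

∫ : ∀ {X} → Meas X → (X → ℚ) → ℚ
∫ ∅             h = 0ℚ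
∫ (δ x)         h = h x
∫ (m ⊕ m′)      h = ∫ m h + ∫ m′ h
∫ (scale a _ m) h = a * ∫ m h
∫ (m >>= g)     h = ∫ m (λ x → ∫ (g x) h)

∫-cong : ∀ {X} (m : Meas X) {h h′ : X → ℚ} → (∀ x → h x ≡ h′ x) → ∫ m h ≡ ∫ m h′
∫-cong ∅             e = refl
∫-cong (δ x)         e = e x
∫-cong (m ⊕ m′)      e = cong₂ _+_ (∫-cong m e) (∫-cong m′ e)
∫-cong (scale a _ m) e = cong (a *_) (∫-cong m e)
∫-cong (m >>= g)     e = ∫-cong m (λ x → ∫-cong (g x) e)

∫-mono : ∀ {X} (m : Meas X) {h h′ : X → ℚ} → (∀ x → h x ≤ h′ x) → ∫ m h ≤ ∫ m h′
∫-mono ∅               e = ≤-refl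
∫-mono (δ x)           e = e x
∫-mono (m ⊕ m′)        e = +-mono-≤ (∫-mono m e) (∫-mono m′ e)
∫-mono (scale a 0≤a m) e = *-mono-nonNeg a 0≤a (∫-mono m e)
∫-mono (m >>= g)       e = ∫-mono m (λ x → ∫-mono (g x) e)

∫-+ : ∀ {X} (m : Meas X) (h h′ : X → ℚ) → ∫ m (λ x → h x + h′ x) ≡ ∫ m h + ∫ m h′
∫-+ ∅             h h′ = refl
∫-+ (δ x)         h h′ = refl
∫-+ (m ⊕ m′)      h h′ = trans (cong₂ _+_ (∫-+ m h h′) (∫-+ m′ h h′))
  (solve 4 (λ a b c d → (a :+ b) :+ (c :+ d) := (a :+ c) :+ (b :+ d)) refl (∫ m h) (∫ m h′) (∫ m′ h) (∫ m′ h′))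
∫-+ (scale a _ m) h h′ = trans (cong (a *_) (∫-+ m h h′)) (*-distribˡ-+ a _ _)
∫-+ (m >>= g)     h h′ = trans (∫-cong m (λ x → ∫-+ (g x) h h′)) (∫-+ m _ _)

∫-* : ∀ {X} (m : Meas X) c (h : X → ℚ) → ∫ m (λ x → c * h x) ≡ c * ∫ m h
∫-* ∅             c h = sym (*-zeroʳ c)
∫-* (δ x)         c h = refl
∫-* (m ⊕ m′)      c h = trans (cong₂ _+_ (∫-* m c h) (∫-* m′ c h)) (sym (*-distribˡ-+ c _ _))
∫-* (scale a _ m) c h = trans (cong (a *_) (∫-* m c h))
  (solve 3 (λ a c x → a :* (c :* x) := c :* (a :* x)) refl a c (∫ m h))
∫-* (m >>= g)     c h = trans (∫-cong m (λ x → ∫-* (g x) c h)) (∫-* m c _)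

∫-0 : ∀ {X} (m : Meas X) → ∫ m (λ _ → 0ℚ) ≡ 0ℚ
∫-0 m = trans (∫-* m 0ℚ (λ _ → 0ℚ)) (*-zeroˡ (∫ m (λ _ → 0ℚ)))

∫-const : ∀ {X} (m : Meas X) c → ∫ m (λ _ → c) ≡ c * ∫ m (λ _ → 1ℚ)
∫-const m c = trans (∫-cong m (λ _ → sym (*-identityʳ c))) (∫-* m c _)

∫-nonNeg : ∀ {X} (m : Meas X) {h : X → ℚ} → (∀ x → 0ℚ ≤ h x) → 0ℚ ≤ ∫ m h
∫-nonNeg m e = ≤-trans (≤-reflexive (sym (∫-0 m))) (∫-mono m e)

∫-sub : ∀ {X} (m : Meas X) (h h′ : X → ℚ) → ∫ m (λ x → h x - h′ x) ≡ ∫ m h - ∫ m h′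
∫-sub m h h′ = trans (∫-cong m (λ x → lem (h x) (h′ x))) (trans (∫-+ m _ _)
    (trans (cong (∫ m h +_) (∫-* m (- 1ℚ) h′)) (sym (lem (∫ m h) (∫ m h′)))))
  where
  lem : ∀ a b → a - b ≡ a + - 1ℚ * b
  lem a b = solve 2 (λ a b → a :- b := a :+ con (- 1ℚ) :* b) refl a b

∫-swap : ∀ {X Y} (m : Meas X) (m′ : Meas Y) (h : X → Y → ℚ) →
         ∫ m (λ x → ∫ m′ (h x)) ≡ ∫ m′ (λ y → ∫ m (λ x → h x y))
∫-swap ∅             m′ h = sym (∫-0 m′)
∫-swap (δ x)         m′ h = refl
∫-swap (m₁ ⊕ m₂)     m′ h = trans (cong₂ _+_ (∫-swap m₁ m′ h) (∫-swap m₂ m′ h)) (sym (∫-+ m′ _ _))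
∫-swap (scale a _ m) m′ h = trans (cong (a *_) (∫-swap m m′ h)) (sym (∫-* m′ a _))
∫-swap (m >>= g)     m′ h = trans (∫-cong m (λ x → ∫-swap (g x) m′ h)) (∫-swap m m′ _)

-- Conditional expectations and the spectrum

-- The fragment of total mass one (`𝔼-const`) generated by fair bits. It stays syntactic so that
-- `flips` can turn the same program into the coin nodes of an `Alg`.
data Coin : Set → Set₁ where
  ret    : ∀ {X} → X → Coin X
  bit    : Coin Bool
  _>>=ᶜ_ : ∀ {X Y} → Coin X → (X → Coin Y) → Coin Y

infixl 1 _>>=ᶜ_

⟦_⟧ : ∀ {X} → Coin X → Meas X
⟦ ret x ⟧    = δ x
⟦ bit ⟧      = scale ½ 0≤½ (δ true ⊕ δ false)
⟦ c >>=ᶜ g ⟧ = ⟦ c ⟧ >>= λ x → ⟦ g x ⟧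

𝔼 : ∀ {X} → Coin X → (X → ℚ) → ℚ
𝔼 c h = ∫ ⟦ c ⟧ h

½+½ : ∀ a → ½ * (a + a) ≡ a
½+½ a = solve 1 (λ a → con ½ :* (a :+ a) := a) refl a

𝔼-const : ∀ {X} (c : Coin X) a → 𝔼 c (λ _ → a) ≡ a
𝔼-const (ret x)    a = refl
𝔼-const bit        a = ½+½ a
𝔼-const (c >>=ᶜ g) a = trans (∫-cong ⟦ c ⟧ (λ x → 𝔼-const (g x) a)) (𝔼-const c a)

cube : ∀ n → Coin (Cube n)
cube zero    = ret []
cube (suc n) = bit >>=ᶜ λ b → cube n >>=ᶜ λ x → ret (b ∷ x)

E≡𝔼 : ∀ n h → E n h ≡ 𝔼 (cube n) h
E≡𝔼 zero    h = refl
E≡𝔼 (suc n) h = cong₂ (λ a b → ½ * (a + b)) (E≡𝔼 n _) (E≡𝔼 n _)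

infixl 7 _·_
_·_ : ∀ {X : Set} → (X → ℚ) → (X → ℚ) → X → ℚ
(F · G) x = F x * G x

avg dif : ∀ {X : Set} → (X → ℚ) → (X → ℚ) → X → ℚ
avg F G x = ½ * (F x + G x)
dif F G x = ½ * (F x - G x)

_↾_ : ∀ {n} → (Cube (suc n) → ℚ) → Bool → Cube n → ℚ
(F ↾ b) x = F (b ∷ x)

infixl 8 _↾_

-- E[F | x_A]
proj : ∀ {n} → Subset n → (Cube n → ℚ) → Cube n → ℚ
proj []          F []      = F []
proj (true ∷ A)  F (b ∷ x) = proj A (F ↾ b) x
proj (false ∷ A) F (b ∷ x) = proj A (avg (F ↾ true) (F ↾ false)) x

proj-cong : ∀ {n} (A : Subset n) {F G} → (∀ x → F x ≡ G x) → ∀ x → proj A F x ≡ proj A G x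
proj-cong []          e []      = e []
proj-cong (true ∷ A)  e (b ∷ x) = proj-cong A (λ y → e (b ∷ y)) x
proj-cong (false ∷ A) e (b ∷ x) = proj-cong A (λ y → cong₂ (λ u v → ½ * (u + v)) (e _) (e _)) x

proj-avg : ∀ {n} (A : Subset n) F G x → proj A (avg F G) x ≡ avg (proj A F) (proj A G) x
proj-avg []          F G []      = refl
proj-avg (true ∷ A)  F G (b ∷ x) = proj-avg A (F ↾ b) (G ↾ b) x
proj-avg (false ∷ A) F G (b ∷ x) = trans
  (proj-cong A (λ y → solve 4 (λ a b c d → con ½ :* (con ½ :* (a :+ b) :+ con ½ :* (c :+ d))
                                        := con ½ :* (con ½ :* (a :+ c) :+ con ½ :* (b :+ d))) refl
                 (F (true ∷ y)) (G (true ∷ y)) (F (false ∷ y)) (G (false ∷ y))) x)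
  (proj-avg A (avg (F ↾ true) (F ↾ false)) (avg (G ↾ true) (G ↾ false)) x)

merge : ∀ {n} → Subset n → Cube n → Cube n → Cube n
merge []          []      []      = []
merge (true ∷ A)  (b ∷ x) (c ∷ y) = b ∷ merge A x y
merge (false ∷ A) (b ∷ x) (c ∷ y) = c ∷ merge A x y

avg-∫ : ∀ {X} (m : Meas X) F G → ½ * (∫ m F + ∫ m G) ≡ ∫ m (avg F G)
avg-∫ m F G = sym (trans (∫-* m ½ _) (cong (½ *_) (∫-+ m F G)))

-- This makes conditional expectations accessible to an oracle: for uniform y, one evaluation at
-- `merge A x y` is an unbiased sample of `proj A F x`.
𝔼-merge : ∀ {n} (A : Subset n) F x → 𝔼 (cube n) (λ y → F (merge A x y)) ≡ proj A F x
𝔼-merge []          F []      = refl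
𝔼-merge (true ∷ A)  F (b ∷ x) = trans (½+½ _) (𝔼-merge A (F ↾ b) x)
𝔼-merge {suc n} (false ∷ A) F (b ∷ x) = trans (avg-∫ ⟦ cube n ⟧ _ _)
  (𝔼-merge A (avg (F ↾ true) (F ↾ false)) x)

ind : Bool → ℚ
ind true  = 1ℚ
ind false = 0ℚ

_⊆ᵇ_ : ∀ {n} → Subset n → Subset n → Bool
[]          ⊆ᵇ []      = true
(true ∷ U)  ⊆ᵇ (b ∷ A) = b ∧ (U ⊆ᵇ A)
(false ∷ U) ⊆ᵇ (b ∷ A) = U ⊆ᵇ A

-- the spectral measure, giving U the mass of the squared Fourier coefficient of F at U
spec : ∀ n → (Cube n → ℚ) → Meas (Subset n)
spec zero    F = scale (F [] * F []) (0≤sq (F [])) (δ [])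
spec (suc n) F = (spec n (dif (F ↾ true) (F ↾ false)) >>= λ U → δ (true ∷ U))
               ⊕ (spec n (avg (F ↾ true) (F ↾ false)) >>= λ U → δ (false ∷ U))

spec-cong : ∀ n {F G} → (∀ x → F x ≡ G x) → ∀ h → ∫ (spec n F) h ≡ ∫ (spec n G) h
spec-cong zero    e h = cong (λ z → z * z * h []) (e [])
spec-cong (suc n) e h = cong₂ _+_
  (spec-cong n (λ x → cong₂ (λ u v → ½ * (u - v)) (e _) (e _)) _)
  (spec-cong n (λ x → cong₂ (λ u v → ½ * (u + v)) (e _) (e _)) _)

-- Fourier coefficients are linear in the function, so on each of them this is ((a-b)/2)² +
-- ((a+b)/2)² = (a²+b²)/2. It plays the part of Parseval: it relates the mass of a function to that
-- of its two restrictions. The induction works because splitting along the first coordinate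
-- commutes with `dif F G` and `avg F G`.
parallelogram : ∀ n F G h → ∫ (spec n (dif F G)) h + ∫ (spec n (avg F G)) h
                          ≡ ½ * (∫ (spec n F) h + ∫ (spec n G) h)
parallelogram zero F G h = solve 3 (λ f g c →
    con ½ :* (f :- g) :* (con ½ :* (f :- g)) :* c :+ con ½ :* (f :+ g) :* (con ½ :* (f :+ g)) :* c
    := con ½ :* (f :* f :* c :+ g :* g :* c)) refl (F []) (G []) (h [])
parallelogram (suc n) F G h = trans (cong₂ _+_
      (cong₂ _+_ (spec-cong n {dif (dif F G ↾ true) (dif F G ↾ false)} {dif dF dG}
          (λ x → dd (F (true ∷ x)) (G (true ∷ x)) (F (false ∷ x)) (G (false ∷ x))) ht)
                 (spec-cong n {avg (dif F G ↾ true) (dif F G ↾ false)} {dif aF aG}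
                     (λ x → ad (F (true ∷ x)) (G (true ∷ x)) (F (false ∷ x)) (G (false ∷ x))) hf))
      (cong₂ _+_ (spec-cong n {dif (avg F G ↾ true) (avg F G ↾ false)} {avg dF dG}
          (λ x → da (F (true ∷ x)) (G (true ∷ x)) (F (false ∷ x)) (G (false ∷ x))) ht)
                 (spec-cong n {avg (avg F G ↾ true) (avg F G ↾ false)} {avg aF aG}
                     (λ x → aa (F (true ∷ x)) (G (true ∷ x)) (F (false ∷ x)) (G (false ∷ x))) hf)))
    (trans (solve 4 (λ a b c d → (a :+ b) :+ (c :+ d) := (a :+ c) :+ (b :+ d)) refl
        (∫ (spec n (dif dF dG)) ht) (∫ (spec n (dif aF aG)) hf) (∫ (spec n (avg dF dG)) ht) (∫ (spec n (avg aF aG)) hf))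
    (trans (cong₂ _+_ (parallelogram n dF dG ht) (parallelogram n aF aG hf))
      (solve 4 (λ a b c d → con ½ :* (a :+ b) :+ con ½ :* (c :+ d) := con ½ :* (a :+ c :+ (b :+ d))) refl
        (∫ (spec n dF) ht) (∫ (spec n dG) ht) (∫ (spec n aF) hf) (∫ (spec n aG) hf))))
  where
  dF dG aF aG : Cube n → ℚ
  dF = dif (F ↾ true) (F ↾ false)
  dG = dif (G ↾ true) (G ↾ false)
  aF = avg (F ↾ true) (F ↾ false)
  aG = avg (G ↾ true) (G ↾ false)
  ht hf : Subset n → ℚ
  ht U = h (true ∷ U)
  hf U = h (false ∷ U)
  dd = solve 4 (λ a b c d → con ½ :* (con ½ :* (a :- b) :- con ½ :* (c :- d)) := con ½ :*
      (con ½ :* (a :- c) :- con ½ :* (b :- d))) refl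
  ad = solve 4 (λ a b c d → con ½ :* (con ½ :* (a :- b) :+ con ½ :* (c :- d)) := con ½ :*
      (con ½ :* (a :+ c) :- con ½ :* (b :+ d))) refl
  da = solve 4 (λ a b c d → con ½ :* (con ½ :* (a :+ b) :- con ½ :* (c :+ d)) := con ½ :*
      (con ½ :* (a :- c) :+ con ½ :* (b :- d))) refl
  aa = solve 4 (λ a b c d → con ½ :* (con ½ :* (a :+ b) :+ con ½ :* (c :+ d)) := con ½ :*
      (con ½ :* (a :+ c) :+ con ½ :* (b :+ d))) refl

weight : ∀ {n} → (Cube n → ℚ) → Subset n → ℚ
weight {n} F A = ∫ (spec n F) (λ U → ind (U ⊆ᵇ A))

-- Projections delete the coefficients outside their set, so by orthogonality only sets inside A ∩ B
-- = A contribute. Taking A = B gives second moments; nested sets give the cross term for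
-- Pythagoras.
𝔼-proj-proj : ∀ {n} (A B : Subset n) → (A ⊆ᵇ B) ≡ true → ∀ F →
              𝔼 (cube n) (proj A F · proj B F) ≡ weight F A
𝔼-proj-proj []          []          _ F = sym (*-identityʳ _)
𝔼-proj-proj {suc n} (true ∷ A)  (true ∷ B)  p F = trans
  (cong₂ (λ u v → ½ * (u + v)) (𝔼-proj-proj A B p (F ↾ true)) (𝔼-proj-proj A B p (F ↾ false)))
  (sym (parallelogram n (F ↾ true) (F ↾ false) (λ U → ind (U ⊆ᵇ A))))
𝔼-proj-proj {suc n} (false ∷ A) (false ∷ B) p F = trans (½+½ _) (trans
  (𝔼-proj-proj A B p (avg (F ↾ true) (F ↾ false)))
  (sym (trans (cong (_+ weight (avg (F ↾ true) (F ↾ false)) A) (∫-0 (spec n (dif (F ↾ true) (F ↾ false)))))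
      (+-identityˡ _))))
𝔼-proj-proj {suc n} (false ∷ A) (true ∷ B)  p F = trans (avg-∫ ⟦ cube n ⟧ _ _) (trans
  (∫-cong ⟦ cube n ⟧ (λ x → trans
    (solve 3 (λ u v w → con ½ :* (u :* v :+ u :* w) := u :* (con ½ :* (v :+ w))) refl
       (proj A aF x) (proj B (F ↾ true) x) (proj B (F ↾ false) x))
    (cong (proj A aF x *_) (sym (proj-avg B (F ↾ true) (F ↾ false) x)))))
  (trans (𝔼-proj-proj A B p aF)
  (sym (trans (cong (_+ weight aF A) (∫-0 (spec n (dif (F ↾ true) (F ↾ false))))) (+-identityˡ _)))))
  where
  aF = avg (F ↾ true) (F ↾ false)

avg-abs : ∀ a b → ∣ ½ * (a + b) ∣ ≤ ½ * (∣ a ∣ + ∣ b ∣)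
avg-abs a b = ≤-trans (≤-reflexive (∣p*q∣≡∣p∣*∣q∣ ½ (a + b))) (*-mono-nonNeg ½ 0≤½ (∣p+q∣≤∣p∣+∣q∣ a b))

norm₁ : ∀ {n} → (Cube n → ℚ) → ℚ
norm₁ {n} F = 𝔼 (cube n) (λ x → ∣ F x ∣)

-- Projecting to the smaller set averages the larger projection further, and averaging cannot
-- increase absolute values.
norm₁-proj-mono : ∀ {n} (A B : Subset n) → (A ⊆ᵇ B) ≡ true → ∀ F → norm₁ (proj A F) ≤ norm₁ (proj B F)
norm₁-proj-mono []          []          _ F = ≤-refl
norm₁-proj-mono (true ∷ A)  (true ∷ B)  p F = *-mono-nonNeg ½ 0≤½
  (+-mono-≤ (norm₁-proj-mono A B p (F ↾ true)) (norm₁-proj-mono A B p (F ↾ false)))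
norm₁-proj-mono (false ∷ A) (false ∷ B) p F = *-mono-nonNeg ½ 0≤½
  (+-mono-≤ (norm₁-proj-mono A B p _) (norm₁-proj-mono A B p _))
norm₁-proj-mono {suc n} (false ∷ A) (true ∷ B)  p F =
  ≤-trans (≤-reflexive (½+½ _)) (≤-trans (norm₁-proj-mono A B p (avg (F ↾ true) (F ↾ false)))
  (≤-trans (∫-mono ⟦ cube n ⟧ (λ x → ≤-trans
      (≤-reflexive (cong ∣_∣ (proj-avg B (F ↾ true) (F ↾ false) x)))
      (avg-abs (proj B (F ↾ true) x) (proj B (F ↾ false) x))))
    (≤-reflexive (sym (avg-∫ ⟦ cube n ⟧ _ _)))))

Junta : ∀ {n} {Y : Set} → Subset n → (Cube n → Y) → Set
Junta S g = ∀ x y → AgreeOn S x y → g x ≡ g y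

agree-in : ∀ {n} {S : Subset n} b {x y} → AgreeOn S x y → AgreeOn (true ∷ S) (b ∷ x) (b ∷ y)
agree-in b h zero    p         = refl
agree-in b h (suc i) (there p) = h i p

agree-out : ∀ {n} {S : Subset n} {b c x y} → AgreeOn S x y → AgreeOn (false ∷ S) (b ∷ x) (c ∷ y)
agree-out h (suc i) (there p) = h i p

-- The tower property: g is constant on the fibres over S, so F may be averaged along each fibre
-- first.
𝔼-junta : ∀ {n} (S : Subset n) (g F : Cube n → ℚ) → Junta S g → 𝔼 (cube n) (g · F) ≡ 𝔼 (cube n) (g · proj S F)
𝔼-junta []          g F J = refl
𝔼-junta (true ∷ S)  g F J = cong₂ (λ u v → ½ * (u + v)) (step true) (step false)
  where
  step : ∀ b → _
  step b = 𝔼-junta S (g ↾ b) (F ↾ b) (λ x y h → J _ _ (agree-in b h))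
𝔼-junta {suc n} (false ∷ S) g F J = trans (avg-∫ ⟦ cube n ⟧ _ _) (trans
  (∫-cong ⟦ cube n ⟧ (λ x → trans (cong (λ z → ½ * (g (true ∷ x) * F (true ∷ x) + z * F (false ∷ x))) (same x))
    (solve 3 (λ u v w → con ½ :* (u :* v :+ u :* w) := u :* (con ½ :* (v :+ w))) refl
       (g (true ∷ x)) (F (true ∷ x)) (F (false ∷ x)))))
  (trans (𝔼-junta S (g ↾ true) aF (λ x y h → J _ _ (agree-out h)))
  (trans (sym (½+½ _)) (cong (λ z → ½ * (𝔼 (cube n) ((g ↾ true) · proj S aF) + z))
    (∫-cong ⟦ cube n ⟧ (λ x → cong (_* proj S aF x) (sym (same x))))))))
  where
  aF = avg (F ↾ true) (F ↾ false)
  same : ∀ x → g (false ∷ x) ≡ g (true ∷ x)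
  same x = J _ _ (agree-out (λ _ _ → refl))

proj-junta : ∀ {n} (S : Subset n) F → Junta S (proj S F)
proj-junta []          F []      []      h = refl
proj-junta (true ∷ S)  F (b ∷ x) (c ∷ y) h rewrite h zero here = proj-junta S (F ↾ c) x y (λ i p → h (suc i) (there p))
proj-junta (false ∷ S) F (b ∷ x) (c ∷ y) h = proj-junta S _ x y (λ i p → h (suc i) (there p))

-- Juntas and influences

⊆ᵇ-refl : ∀ {n} (A : Subset n) → (A ⊆ᵇ A) ≡ true
⊆ᵇ-refl []          = refl
⊆ᵇ-refl (true ∷ A)  = ⊆ᵇ-refl A
⊆ᵇ-refl (false ∷ A) = ⊆ᵇ-refl A

*-cancel-pos : ∀ {a b} c → 0ℚ < c → c * a ≤ c * b → a ≤ b
*-cancel-pos c 0<c = *-cancelˡ-≤-pos c {{positive 0<c}}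

abs-sq : ∀ a → ∣ a ∣ * ∣ a ∣ ≡ a * a
abs-sq a with ∣p∣≡p∨∣p∣≡-p a
... | inj₁ e = cong₂ _*_ e e
... | inj₂ e = trans (cong₂ _*_ e e) (solve 1 (λ a → (:- a) :* (:- a) := a :* a) refl a)

-- Cauchy-Schwarz without a root: integrate 2a|h| ≤ h² + a² and divide by 2a.
𝔼-abs≤ : ∀ {X} (c : Coin X) (h : X → ℚ) a → 0ℚ < a → 𝔼 c (h · h) ≤ a * a → 𝔼 c (λ x → ∣ h x ∣) ≤ a
𝔼-abs≤ c h a 0<a h²≤ = *-cancel-pos (a + a) (+-mono-< 0<a 0<a) (≤-trans
  (≤-reflexive (sym (∫-* ⟦ c ⟧ (a + a) (λ x → ∣ h x ∣))))
  (≤-trans (∫-mono ⟦ c ⟧ amgm)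
  (≤-trans (≤-reflexive (trans (∫-+ ⟦ c ⟧ (h · h) (λ _ → a * a)) (cong (𝔼 c (h · h) +_) (𝔼-const c (a * a)))))
  (≤-trans (+-monoˡ-≤ (a * a) h²≤) (≤-reflexive (sym (*-distribʳ-+ a a a)))))))
  where
  amgm : ∀ x → (a + a) * ∣ h x ∣ ≤ h x * h x + a * a
  amgm x = ≤-by ((∣ h x ∣ - a) * (∣ h x ∣ - a)) (0≤sq (∣ h x ∣ - a))
    (trans (cong (_+ a * a) (sym (abs-sq (h x))))
      (solve 2 (λ u a → u :* u :+ a :* a := (a :+ a) :* u :+ (u :- a) :* (u :- a)) refl ∣ h x ∣ a))

variance-identity : ∀ {X} (c : Coin X) (h : X → ℚ) μ → 𝔼 c h ≡ μ →
                    𝔼 c (λ x → (h x - μ) * (h x - μ)) ≡ 𝔼 c (h · h) - μ * μ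
variance-identity c h μ refl = trans
  (∫-cong ⟦ c ⟧ (λ x → solve 2 (λ u m → (u :- m) :* (u :- m) := u :* u :+ ((:- (m :+ m)) :* u :+ m :* m)) refl (h x) μ))
  (trans (∫-+ ⟦ c ⟧ (h · h) _) (trans (cong (𝔼 c (h · h) +_)
      (trans (∫-+ ⟦ c ⟧ _ _) (cong₂ _+_ (∫-* ⟦ c ⟧ (- (μ + μ)) h) (𝔼-const c (μ * μ)))))
    (solve 2 (λ m e → e :+ ((:- (m :+ m)) :* m :+ m :* m) := e :- m :* m) refl μ (𝔼 c (h · h)))))

jensen-sq : ∀ {X} (c : Coin X) (h : X → ℚ) → 𝔼 c h * 𝔼 c h ≤ 𝔼 c (h · h)
jensen-sq c h = ≤-from-diff (≤-trans (∫-nonNeg ⟦ c ⟧ (λ x → 0≤sq (h x - 𝔼 c h)))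
  (≤-reflexive (variance-identity c h (𝔼 c h) refl)))

-- By Pythagoras the difference of the two projections has second moment W(B) - W(A), which `𝔼-abs≤`
-- turns into an L¹ bound.
norm₁-proj-close : ∀ {n} (A B : Subset n) → (A ⊆ᵇ B) ≡ true → ∀ F a → 0ℚ < a →
                   weight F B - weight F A ≤ a * a → norm₁ (proj B F) ≤ norm₁ (proj A F) + a
norm₁-proj-close {n} A B A⊆B F a 0<a W≤ = ≤-trans
  (∫-mono ⟦ cube n ⟧ (λ x → ≤-trans (≤-reflexive (cong ∣_∣ (solve 2 (λ u v → u := v :+ (u :- v)) refl (proj B F x)
      (proj A F x))))
     (∣p+q∣≤∣p∣+∣q∣ (proj A F x) (d x))))
  (≤-trans (≤-reflexive (∫-+ ⟦ cube n ⟧ _ _))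
  (+-monoʳ-≤ (norm₁ (proj A F)) (𝔼-abs≤ (cube n) d a 0<a (≤-trans (≤-reflexive d²) W≤))))
  where
  d : Cube n → ℚ
  d x = proj B F x - proj A F x
  d² : 𝔼 (cube n) (d · d) ≡ weight F B - weight F A
  d² = trans (∫-cong ⟦ cube n ⟧ (λ x → solve 2 (λ u v → (u :- v) :* (u :- v) := (u :* u :+ v :* v) :+ con (- 1ℚ + - 1ℚ)
      :* (v :* u)) refl (proj B F x) (proj A F x)))
    (trans (∫-+ ⟦ cube n ⟧ _ _) (trans (cong₂ _+_
      (trans (∫-+ ⟦ cube n ⟧ _ _) (cong₂ _+_ (𝔼-proj-proj B B (⊆ᵇ-refl B) F) (𝔼-proj-proj A A (⊆ᵇ-refl A) F)))
      (trans (∫-* ⟦ cube n ⟧ (- 1ℚ + - 1ℚ) _) (cong ((- 1ℚ + - 1ℚ) *_) (𝔼-proj-proj A B A⊆B F))))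
    (solve 2 (λ b a → b :+ a :+ con (- 1ℚ + - 1ℚ) :* a := b :- a) refl (weight F B) (weight F A))))

val : Bool → ℚ
val true  = 1ℚ
val false = - 1ℚ

sgnProd≡ : ∀ a b → sgnProd a b ≡ val a * val b
sgnProd≡ true  true  = refl
sgnProd≡ true  false = refl
sgnProd≡ false true  = refl
sgnProd≡ false false = refl

⟨_⟩ : ∀ {n} → BoolFn n → Cube n → ℚ
⟨ f ⟩ x = val (f x)

val²≡1 : ∀ b → val b * val b ≡ 1ℚ
val²≡1 true  = refl
val²≡1 false = refl

corr-junta : ∀ {n} (S : Subset n) (g f : BoolFn n) → Junta S g → corr n g f ≡ 𝔼 (cube n) (⟨ g ⟩ · proj S ⟨ f ⟩)
corr-junta {n} S g f J = trans (E≡𝔼 n _) (trans (∫-cong ⟦ cube n ⟧ (λ x → sgnProd≡ (g x) (f x)))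
  (𝔼-junta S ⟨ g ⟩ ⟨ f ⟩ (λ x y h → cong val (J x y h))))

val*≤abs : ∀ b a → val b * a ≤ ∣ a ∣
val*≤abs b a with ≤-total 0ℚ a
val*≤abs true  a | inj₁ 0≤a = ≤-reflexive (trans (*-identityˡ a) (sym (0≤p⇒∣p∣≡p 0≤a)))
val*≤abs false a | inj₁ 0≤a = ≤-trans (≤-trans (≤-reflexive (solve 1 (λ a → con (- 1ℚ) :* a := :- a) refl a))
    (neg-antimono-≤ 0≤a)) (0≤∣p∣ a)
val*≤abs true  a | inj₂ a≤0 = ≤-trans (≤-trans (≤-reflexive (*-identityˡ a)) a≤0) (0≤∣p∣ a)
val*≤abs false a | inj₂ a≤0 = ≤-reflexive (trans (solve 1 (λ a → con (- 1ℚ) :* a := :- a) refl a)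
   (trans (sym (0≤p⇒∣p∣≡p (neg-antimono-≤ a≤0))) (∣-p∣≡∣p∣ a)))

corr≤norm₁ : ∀ {n} (S : Subset n) (g f : BoolFn n) → Junta S g → corr n g f ≤ norm₁ (proj S ⟨ f ⟩)
corr≤norm₁ {n} S g f J = ≤-trans (≤-reflexive (corr-junta S g f J))
  (∫-mono ⟦ cube n ⟧ (λ x → val*≤abs (g x) (proj S ⟨ f ⟩ x)))

sign : ℚ → Bool
sign a with ≤-total 0ℚ a
... | inj₁ _ = true
... | inj₂ _ = false

val-sign : ∀ a → val (sign a) * a ≡ ∣ a ∣
val-sign a with ≤-total 0ℚ a
... | inj₁ 0≤a = trans (*-identityˡ a) (sym (0≤p⇒∣p∣≡p 0≤a))
... | inj₂ a≤0 = trans (solve 1 (λ a → con (- 1ℚ) :* a := :- a) refl a)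
                   (trans (sym (0≤p⇒∣p∣≡p (neg-antimono-≤ a≤0))) (∣-p∣≡∣p∣ a))

sign-proj : ∀ {n} → Subset n → BoolFn n → BoolFn n
sign-proj S f x = sign (proj S ⟨ f ⟩ x)

sign-proj-junta : ∀ {n} (S : Subset n) (f : BoolFn n) → Junta S (sign-proj S f)
sign-proj-junta S f x y h = cong sign (proj-junta S ⟨ f ⟩ x y h)

corr-sign-proj : ∀ {n} (S : Subset n) (f : BoolFn n) → corr n (sign-proj S f) f ≡ norm₁ (proj S ⟨ f ⟩)
corr-sign-proj {n} S f = trans (corr-junta S (sign-proj S f) f (sign-proj-junta S f))
  (∫-cong ⟦ cube n ⟧ (λ x → val-sign (proj S ⟨ f ⟩ x)))

meets : ∀ {n} → Subset n → Subset n → Bool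
meets []      []      = false
meets (u ∷ U) (b ∷ B) = (u ∧ b) ∨ meets U B

_∖_ : ∀ {n} → Subset n → Subset n → Subset n
_∖_ = zipWith (λ a b → a ∧ not b)

⊆ᵇ-∖ : ∀ {n} (U A B : Subset n) → ind (U ⊆ᵇ A) - ind (U ⊆ᵇ (A ∖ B)) ≡ ind (U ⊆ᵇ A) * ind (meets U B)
⊆ᵇ-∖ []          []          []          = refl
⊆ᵇ-∖ (false ∷ U) (a ∷ A)     (b ∷ B)     = ⊆ᵇ-∖ U A B
⊆ᵇ-∖ (true ∷ U)  (false ∷ A) (b ∷ B)     = sym (*-zeroˡ (ind (b ∨ meets U B)))
⊆ᵇ-∖ (true ∷ U)  (true ∷ A)  (false ∷ B) = ⊆ᵇ-∖ U A B
⊆ᵇ-∖ (true ∷ U)  (true ∷ A)  (true ∷ B)  = solve 1 (λ u → u :- con 0ℚ := u :* con 1ℚ) refl (ind (U ⊆ᵇ A))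

_^_ : ℚ → ℕ → ℚ
a ^ zero  = 1ℚ
a ^ suc n = a * a ^ n

infixr 8 _^_

^-nonNeg : ∀ {a} → 0ℚ ≤ a → ∀ n → 0ℚ ≤ a ^ n
^-nonNeg 0≤a zero    = nonNegative⁻¹ 1ℚ
^-nonNeg 0≤a (suc n) = 0≤* 0≤a (^-nonNeg 0≤a n)

^-antitone : ∀ {a} → 0ℚ ≤ a → a ≤ 1ℚ → ∀ {m n} → m ℕ.≤ n → a ^ n ≤ a ^ m
^-antitone 0≤a a≤1 {n = zero}  ℕ.z≤n = ≤-refl
^-antitone {a} 0≤a a≤1 {n = suc n} ℕ.z≤n = ≤-trans (*-mono₂ 0≤a (nonNegative⁻¹ 1ℚ) a≤1
    (^-antitone 0≤a a≤1 {n = n} ℕ.z≤n)) (≤-reflexive (*-identityˡ 1ℚ))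
^-antitone {a} 0≤a a≤1 (ℕ.s≤s m≤n) = *-mono-nonNeg a 0≤a (^-antitone 0≤a a≤1 m≤n)

-- True as soon as one of s fair bits is true. Only dyadic probabilities come from fair coins, hence
-- the noise rate is always a power of 1/2.
bern : ℕ → Coin Bool
bern zero    = ret false
bern (suc s) = bit >>=ᶜ λ b → if b then ret true else bern s

ρ : ℕ → ℚ
ρ s = 1ℚ - ½ ^ s

𝔼-bern : ∀ s h → 𝔼 (bern s) h ≡ ρ s * h true + (1ℚ - ρ s) * h false
𝔼-bern zero    h = solve 2 (λ t f → f := (con 1ℚ :- con 1ℚ) :* t :+ (con 1ℚ :- (con 1ℚ :- con 1ℚ)) :* f) refl (h true)
    (h false)
𝔼-bern (suc s) h = trans (cong (λ z → ½ * (h true + z)) (𝔼-bern s h))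
  (solve 3 (λ p t f → con ½ :* (t :+ ((con 1ℚ :- p) :* t :+ (con 1ℚ :- (con 1ℚ :- p)) :* f))
     := (con 1ℚ :- con ½ :* p) :* t :+ (con 1ℚ :- (con 1ℚ :- con ½ :* p)) :* f) refl (½ ^ s) (h true) (h false))

½^-≤1 : ∀ s → ½ ^ s ≤ 1ℚ
½^-≤1 s = ^-antitone 0≤½ (≤-by ½ 0≤½ refl) {0} {s} ℕ.z≤n

0≤ρ : ∀ s → 0ℚ ≤ ρ s
0≤ρ s = 0≤-diff (½^-≤1 s)

ρ≤1 : ∀ s → ρ s ≤ 1ℚ
ρ≤1 s = ≤-by (½ ^ s) (^-nonNeg 0≤½ s) (solve 1 (λ p → con 1ℚ := con 1ℚ :- p :+ p) refl (½ ^ s))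

vec : ∀ {X} → Coin X → ∀ n → Coin (Vec X n)
vec c zero    = ret []
vec c (suc n) = c >>=ᶜ λ x → vec c n >>=ᶜ λ xs → ret (x ∷ xs)

𝔼-randomSet : ∀ s {n} (U : Subset n) → 𝔼 (vec (bern s) n) (λ R → ind (U ⊆ᵇ R)) ≡ ρ s ^ card U
𝔼-randomSet s []          = refl
𝔼-randomSet s {suc n} (true ∷ U)  = trans (𝔼-bern s _) (trans
  (cong₂ (λ u v → ρ s * u + (1ℚ - ρ s) * v) (𝔼-randomSet s U) (𝔼-const (vec (bern s) n) 0ℚ))
  (solve 2 (λ a b → a :* b :+ (con 1ℚ :- a) :* con 0ℚ := a :* b) refl (ρ s) (ρ s ^ card U)))
𝔼-randomSet s {suc n} (false ∷ U) = trans (𝔼-const (bern s) _) (𝔼-randomSet s U)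

influence : ∀ {n} → ℚ → (Cube n → ℚ) → Subset n → ℚ
influence {n} r F B = ∫ (spec n F) (λ U → ind (meets U B) * r ^ card U)

coordInfluence : ∀ {n} → ℚ → (Cube n → ℚ) → Fin n → ℚ
coordInfluence {n} r F i = ∫ (spec n F) (λ U → ind (lookup U i) * r ^ card U)

𝔼-proj : ∀ {n} (A : Subset n) F → 𝔼 (cube n) (F · proj A F) ≡ weight F A
𝔼-proj {n} A F = trans (∫-cong ⟦ cube n ⟧ (λ x → *-comm (F x) (proj A F x)))
  (trans (𝔼-junta A (proj A F) F (proj-junta A F)) (𝔼-proj-proj A A (⊆ᵇ-refl A) F))

weight-∖ : ∀ {n} F (A B : Subset n) → weight F A - weight F (A ∖ B) ≡ ∫ (spec n F)
    (λ U → ind (U ⊆ᵇ A) * ind (meets U B))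
weight-∖ {n} F A B = trans (sym (∫-sub (spec n F) _ _)) (∫-cong (spec n F) (λ U → ⊆ᵇ-∖ U A B))

Sample : ℕ → Set
Sample n = Subset n × Cube n × Cube n

sample : ∀ s n → Coin (Sample n)
sample s n = vec (bern s) n >>=ᶜ λ R → cube n >>=ᶜ λ x → cube n >>=ᶜ λ y → ret (R , x , y)

sampleInfluence : ∀ {n} → (Cube n → ℚ) → Subset n → Sample n → ℚ
sampleInfluence F B (R , x , y) = F x * (F (merge R x y) - F (merge (R ∖ B) x y))

-- For fixed R, averaging over y and then x leaves the mass on sets U inside R that meet B.
-- Averaging over R multiplies the mass at U by the probability ρ^|U| that R contains U: this is how
-- the discount is realised with three queries.
𝔼-sampleInfluence : ∀ s {n} F (B : Subset n) → 𝔼 (sample s n) (sampleInfluence F B) ≡ influence (ρ s) F B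
𝔼-sampleInfluence s {n} F B = trans (∫-cong ⟦ vec (bern s) n ⟧ step)
  (trans (∫-swap ⟦ vec (bern s) n ⟧ (spec n F) (λ R U → ind (U ⊆ᵇ R) * ind (meets U B)))
  (∫-cong (spec n F) (λ U → trans (∫-cong ⟦ vec (bern s) n ⟧ (λ R → *-comm (ind (U ⊆ᵇ R)) (ind (meets U B))))
    (trans (∫-* ⟦ vec (bern s) n ⟧ (ind (meets U B)) _) (cong (ind (meets U B) *_) (𝔼-randomSet s U))))))
  where
  step : ∀ R → 𝔼 (cube n) (λ x → 𝔼 (cube n) (λ y → F x * (F (merge R x y) - F (merge (R ∖ B) x y))))
             ≡ ∫ (spec n F) (λ U → ind (U ⊆ᵇ R) * ind (meets U B))
  step R = trans (∫-cong ⟦ cube n ⟧ (λ x → trans (∫-* ⟦ cube n ⟧ (F x) _)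
      (trans (cong (F x *_) (trans (∫-sub ⟦ cube n ⟧ _ _) (cong₂ _-_ (𝔼-merge R F x) (𝔼-merge (R ∖ B) F x))))
        (solve 3 (λ a b c → a :* (b :- c) := a :* b :- a :* c) refl (F x) (proj R F x) (proj (R ∖ B) F x)))))
    (trans (∫-sub ⟦ cube n ⟧ (F · proj R F) (F · proj (R ∖ B) F))
    (trans (cong₂ _-_ (𝔼-proj R F) (𝔼-proj (R ∖ B) F)) (weight-∖ F R B)))

fins : ∀ n → Meas (Fin n)
fins zero    = ∅
fins (suc n) = δ zero ⊕ (fins n >>= λ i → δ (suc i))

∑ : ∀ {n} → (Fin n → ℚ) → ℚ
∑ {n} = ∫ (fins n)

ℕ→ℚ-+ : ∀ a b → ℕ→ℚ (a ℕ.+ b) ≡ ℕ→ℚ a + ℕ→ℚ b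
ℕ→ℚ-+ a b = toℚᵘ-injective (ℚᵘₚ.≃-trans (toℚᵘ-fromℚᵘ (ℚᵘ.mkℚᵘ (ℤ.+ (a ℕ.+ b)) 0))
  (ℚᵘₚ.≃-sym (ℚᵘₚ.≃-trans (toℚᵘ-homo-+ (ℕ→ℚ a) (ℕ→ℚ b))
    (ℚᵘₚ.≃-trans (ℚᵘₚ.+-cong (toℚᵘ-fromℚᵘ (ℚᵘ.mkℚᵘ (ℤ.+ a) 0)) (toℚᵘ-fromℚᵘ (ℚᵘ.mkℚᵘ (ℤ.+ b) 0)))
      (ℚᵘ.*≡* (cong (ℤ._* ℤ.+ 1) (cong₂ ℤ._+_ (ℤₚ.*-identityʳ (ℤ.+ a)) (ℤₚ.*-identityʳ (ℤ.+ b)))))))))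

ℕ→ℚ-* : ∀ a b → ℕ→ℚ (a ℕ.* b) ≡ ℕ→ℚ a * ℕ→ℚ b
ℕ→ℚ-* a b = toℚᵘ-injective (ℚᵘₚ.≃-trans (toℚᵘ-fromℚᵘ (ℚᵘ.mkℚᵘ (ℤ.+ (a ℕ.* b)) 0))
  (ℚᵘₚ.≃-sym (ℚᵘₚ.≃-trans (toℚᵘ-homo-* (ℕ→ℚ a) (ℕ→ℚ b))
    (ℚᵘₚ.≃-trans (ℚᵘₚ.*-cong (toℚᵘ-fromℚᵘ (ℚᵘ.mkℚᵘ (ℤ.+ a) 0)) (toℚᵘ-fromℚᵘ (ℚᵘ.mkℚᵘ (ℤ.+ b) 0)))
      (ℚᵘ.*≡* (cong (ℤ._* ℤ.+ 1) (sym (ℤₚ.pos-* a b))))))))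

ℕ→ℚ-mono : ∀ {a b} → a ℕ.≤ b → ℕ→ℚ a ≤ ℕ→ℚ b
ℕ→ℚ-mono {a} {b} a≤b = toℚᵘ-cancel-≤ (ℚᵘₚ.≤-trans (ℚᵘₚ.≤-reflexive (toℚᵘ-fromℚᵘ (ℚᵘ.mkℚᵘ (ℤ.+ a) 0)))
  (ℚᵘₚ.≤-trans (ℚᵘ.*≤* (ℤₚ.*-monoʳ-≤-nonNeg (ℤ.+ 1) (ℤ.+≤+ a≤b)))
  (ℚᵘₚ.≤-reflexive (ℚᵘₚ.≃-sym (toℚᵘ-fromℚᵘ (ℚᵘ.mkℚᵘ (ℤ.+ b) 0))))))

ℕ→ℚ-cancel : ∀ {a b} → ℕ→ℚ a ≤ ℕ→ℚ b → a ℕ.≤ b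
ℕ→ℚ-cancel {a} {b} h with ℚᵘₚ.≤-trans (ℚᵘₚ.≤-reflexive (ℚᵘₚ.≃-sym (toℚᵘ-fromℚᵘ (ℚᵘ.mkℚᵘ (ℤ.+ a) 0))))
  (ℚᵘₚ.≤-trans (toℚᵘ-mono-≤ h) (ℚᵘₚ.≤-reflexive (toℚᵘ-fromℚᵘ (ℚᵘ.mkℚᵘ (ℤ.+ b) 0))))
... | ℚᵘ.*≤* e = ℤₚ.drop‿+≤+ (subst₂ ℤ._≤_ (ℤₚ.*-identityʳ (ℤ.+ a)) (ℤₚ.*-identityʳ (ℤ.+ b)) e)

0≤ℕ→ℚ : ∀ a → 0ℚ ≤ ℕ→ℚ a
0≤ℕ→ℚ a = ℕ→ℚ-mono {0} {a} ℕ.z≤n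

∑-card : ∀ {n} (S : Subset n) → ∑ (λ i → ind (lookup S i)) ≡ ℕ→ℚ (card S)
∑-card []          = refl
∑-card (true ∷ S)  = trans (cong (1ℚ +_) (∑-card S)) (sym (ℕ→ℚ-+ 1 (card S)))
∑-card (false ∷ S) = trans (+-identityˡ _) (∑-card S)

0≤ind : ∀ b → 0ℚ ≤ ind b
0≤ind true  = nonNegative⁻¹ 1ℚ
0≤ind false = ≤-refl

ind≤1 : ∀ b → ind b ≤ 1ℚ
ind≤1 true  = ≤-refl
ind≤1 false = nonNegative⁻¹ 1ℚ

meets≤∑ : ∀ {n} (U B : Subset n) → ind (meets U B) ≤ ∑ (λ i → ind (lookup B i) * ind (lookup U i))
meets≤∑ []      []      = ≤-refl
meets≤∑ (u ∷ U) (b ∷ B) = ≤-trans (split u b (meets U B)) (+-monoʳ-≤ (ind b * ind u) (meets≤∑ U B))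
  where
  split : ∀ u b c → ind ((u ∧ b) ∨ c) ≤ ind b * ind u + ind c
  split true  true  c     = ≤-by (ind c) (0≤ind c) refl
  split true  false c     = ≤-reflexive (sym (+-identityˡ (ind c)))
  split false true  c     = ≤-reflexive (sym (+-identityˡ (ind c)))
  split false false c     = ≤-reflexive (sym (+-identityˡ (ind c)))

lookup≤meets : ∀ {n} (U B : Subset n) i → lookup B i ≡ true → ind (lookup U i) ≤ ind (meets U B)
lookup≤meets (true ∷ U)  (true ∷ B) zero    refl = ≤-refl
lookup≤meets (false ∷ U) (true ∷ B) zero    refl = 0≤ind (meets U B)
lookup≤meets (true ∷ U)  (true ∷ B) (suc i) e    = ind≤1 (lookup U i)
lookup≤meets (true ∷ U) (false ∷ B) (suc i) e    = lookup≤meets U B i e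
lookup≤meets (false ∷ U)   (b ∷ B)  (suc i) e    = lookup≤meets U B i e

-- A union bound over the elements of B. With `coordInfluence≤` it places a bucket's influence
-- between the largest influence of a member and the sum over members: a low estimate certifies that
-- all members are light, a high one that the sum is large.
influence≤∑ : ∀ {n} r → 0ℚ ≤ r → ∀ F (B : Subset n) →
              influence r F B ≤ ∑ (λ i → ind (lookup B i) * coordInfluence r F i)
influence≤∑ {n} r 0≤r F B = ≤-trans
  (∫-mono (spec n F) (λ U → ≤-trans (*-monoʳ-≤-nonNeg (r ^ card U) {{nonNegative (^-nonNeg 0≤r (card U))}}
      (meets≤∑ U B))
     (≤-reflexive (trans (*-comm _ (r ^ card U)) (sym (∫-* (fins n) (r ^ card U) _))))))
  (≤-reflexive (trans (∫-swap (spec n F) (fins n) _) (∫-cong (fins n) (λ i →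
     trans (∫-cong (spec n F) (λ U → solve 3 (λ a b c → a :* (b :* c) := b :* (c :* a)) refl (r ^ card U)
         (ind (lookup B i)) (ind (lookup U i))))
           (∫-* (spec n F) (ind (lookup B i)) _)))))

coordInfluence≤ : ∀ {n} r → 0ℚ ≤ r → ∀ F (B : Subset n) i → lookup B i ≡ true → coordInfluence r F i ≤ influence r F B
coordInfluence≤ {n} r 0≤r F B i e = ∫-mono (spec n F) (λ U →
  *-monoʳ-≤-nonNeg (r ^ card U) {{nonNegative (^-nonNeg 0≤r (card U))}} (lookup≤meets U B i e))

spec-mass : ∀ n (F : Cube n → ℚ) → (∀ x → F x * F x ≡ 1ℚ) → ∫ (spec n F) (λ _ → 1ℚ) ≡ 1ℚ
spec-mass zero    F e = trans (*-identityʳ _) (e [])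
spec-mass (suc n) F e = trans (parallelogram n (F ↾ true) (F ↾ false) (λ _ → 1ℚ))
  (cong₂ (λ u v → ½ * (u + v)) (spec-mass n _ (λ x → e _)) (spec-mass n _ (λ x → e _)))

-- Exchanging the sums counts each U with multiplicity |U|, giving an average of |U| r^|U| over a
-- measure of mass one. Without the discount it would be the average of |U|, which can reach n.
∑-coordInfluence≤ : ∀ {n} r D → (∀ m → ℕ→ℚ m * r ^ m ≤ D) → ∀ (F : Cube n → ℚ) → (∀ x → F x * F x ≡ 1ℚ) →
                    ∑ (coordInfluence r F) ≤ D
∑-coordInfluence≤ {n} r D mr≤D F e = ≤-trans (≤-reflexive (∫-swap (fins n) (spec n F) _)) (≤-trans
  (∫-mono (spec n F) (λ U → ≤-trans (≤-reflexive (trans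
     (trans (∫-cong (fins n) (λ i → *-comm (ind (lookup U i)) (r ^ card U))) (∫-* (fins n) (r ^ card U) _))
     (trans (*-comm (r ^ card U) _) (cong (_* r ^ card U) (∑-card U))))) (mr≤D (card U))))
  (≤-reflexive (trans (∫-const (spec n F) D) (trans (cong (D *_) (spec-mass n F e)) (*-identityʳ D)))))

0≤coordInfluence : ∀ {n} r → 0ℚ ≤ r → ∀ (F : Cube n → ℚ) i → 0ℚ ≤ coordInfluence r F i
0≤coordInfluence {n} r 0≤r F i = ∫-nonNeg (spec n F) (λ U → 0≤* (0≤ind (lookup U i)) (^-nonNeg 0≤r (card U)))

-- Hashing coordinates into buckets

eqᵇ : ∀ {s} → Cube s → Cube s → Bool
eqᵇ []          []          = true
eqᵇ (true ∷ u)  (true ∷ v)  = eqᵇ u v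
eqᵇ (false ∷ u) (false ∷ v) = eqᵇ u v
eqᵇ (true ∷ u)  (false ∷ v) = false
eqᵇ (false ∷ u) (true ∷ v)  = false

eqᵇ-refl : ∀ {s} (u : Cube s) → eqᵇ u u ≡ true
eqᵇ-refl []          = refl
eqᵇ-refl (true ∷ u)  = eqᵇ-refl u
eqᵇ-refl (false ∷ u) = eqᵇ-refl u

eqᵇ-sound : ∀ {s} (u v : Cube s) → eqᵇ u v ≡ true → u ≡ v
eqᵇ-sound []          []          e = refl
eqᵇ-sound (true ∷ u)  (true ∷ v)  e = cong (true ∷_) (eqᵇ-sound u v e)
eqᵇ-sound (false ∷ u) (false ∷ v) e = cong (false ∷_) (eqᵇ-sound u v e)

𝔼-eqᵇ : ∀ {s} (u : Cube s) → 𝔼 (cube s) (λ v → ind (eqᵇ u v)) ≡ ½ ^ s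
𝔼-eqᵇ []                  = refl
𝔼-eqᵇ {suc s} (true ∷ u)  = cong (½ *_) (trans (cong₂ _+_ (𝔼-eqᵇ u) (𝔼-const (cube s) 0ℚ)) (+-identityʳ (½ ^ s)))
𝔼-eqᵇ {suc s} (false ∷ u) = cong (½ *_) (trans (cong₂ _+_ (𝔼-const (cube s) 0ℚ) (𝔼-eqᵇ u)) (+-identityˡ (½ ^ s)))

𝔼-eqᵇˡ : ∀ {s} (v : Cube s) → 𝔼 (cube s) (λ u → ind (eqᵇ u v)) ≡ ½ ^ s
𝔼-eqᵇˡ []                  = refl
𝔼-eqᵇˡ {suc s} (true ∷ v)  = cong (½ *_) (trans (cong₂ _+_ (𝔼-eqᵇˡ v) (𝔼-const (cube s) 0ℚ)) (+-identityʳ (½ ^ s)))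
𝔼-eqᵇˡ {suc s} (false ∷ v) = cong (½ *_) (trans (cong₂ _+_ (𝔼-const (cube s) 0ℚ) (𝔼-eqᵇˡ v)) (+-identityˡ (½ ^ s)))

𝔼-lookup : ∀ {X} (c : Coin X) n (j : Fin n) g → 𝔼 (vec c n) (λ π → g (lookup π j)) ≡ 𝔼 c g
𝔼-lookup c (suc n) zero    g = ∫-cong ⟦ c ⟧ (λ x → 𝔼-const (vec c n) (g x))
𝔼-lookup c (suc n) (suc j) g = trans (𝔼-const c _) (𝔼-lookup c n j g)

Hash : ℕ → ℕ → Set
Hash s n = Vec (Cube s) n

hash : ∀ s n → Coin (Hash s n)
hash s = vec (cube s)

collide : ∀ {s n} → Hash s n → Fin n → Fin n → Bool
collide π i j = eqᵇ (lookup π i) (lookup π j)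

𝔼-collide : ∀ {s n} (i j : Fin n) → i ≢ j → 𝔼 (hash s n) (λ π → ind (collide π i j)) ≡ ½ ^ s
𝔼-collide zero    zero    i≢j = ⊥-elim (i≢j refl)
𝔼-collide {s} {suc n} zero (suc j) i≢j = trans
  (∫-cong ⟦ cube s ⟧ (λ u → trans (𝔼-lookup (cube s) n j (λ v → ind (eqᵇ u v))) (𝔼-eqᵇ u))) (𝔼-const (cube s) (½ ^ s))
𝔼-collide {s} {suc n} (suc i) zero i≢j = trans
  (∫-cong ⟦ cube s ⟧ (λ v → trans (𝔼-lookup (cube s) n i (λ u → ind (eqᵇ u v))) (𝔼-eqᵇˡ v))) (𝔼-const (cube s) (½ ^ s))
𝔼-collide {s} {suc n} (suc i) (suc j) i≢j = trans (𝔼-const (cube s) _) (𝔼-collide i j (λ e → i≢j (cong suc e)))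

eqF : ∀ {n} → Fin n → Fin n → Bool
eqF zero    zero    = true
eqF zero    (suc j) = false
eqF (suc i) zero    = false
eqF (suc i) (suc j) = eqF i j

eqF-refl : ∀ {n} (i : Fin n) → eqF i i ≡ true
eqF-refl zero    = refl
eqF-refl (suc i) = eqF-refl i

eqF-sound : ∀ {n} (i j : Fin n) → eqF i j ≡ true → i ≡ j
eqF-sound zero    zero    e = refl
eqF-sound (suc i) (suc j) e = cong suc (eqF-sound i j e)

∑-eqF : ∀ {n} (i : Fin n) (a : Fin n → ℚ) → ∑ (λ j → ind (eqF i j) * a j) ≡ a i
∑-eqF {suc n} zero    a = trans (cong₂ _+_ (*-identityˡ (a zero))
  (trans (∫-cong (fins n) (λ j → *-zeroˡ (a (suc j)))) (∫-0 (fins n)))) (+-identityʳ (a zero))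
∑-eqF {suc n} (suc i) a = trans (cong₂ _+_ (*-zeroˡ (a zero)) (∑-eqF i (λ j → a (suc j)))) (+-identityˡ (a (suc i)))

collisionTerm : ∀ {s n} → (Fin n → ℚ) → Hash s n → Fin n → Fin n → ℚ
collisionTerm w π i j = ind (not (eqF i j)) * (w i * w j) * ind (collide π i j)

-- The weights w_i w_j make the mean independent of n; an unweighted count would call for about n²
-- buckets.
collisions : ∀ {s n} → (Fin n → ℚ) → Hash s n → ℚ
collisions w π = ∑ (λ i → ∑ (λ j → collisionTerm w π i j))

0≤collisionTerm : ∀ {s n} (w : Fin n → ℚ) → (∀ i → 0ℚ ≤ w i) → ∀ (π : Hash s n) i j → 0ℚ ≤ collisionTerm w π i j
0≤collisionTerm w 0≤w π i j = 0≤* (0≤* (0≤ind (not (eqF i j))) (0≤* (0≤w i) (0≤w j))) (0≤ind (collide π i j))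

0≤collisions : ∀ {s n} (w : Fin n → ℚ) → (∀ i → 0ℚ ≤ w i) → ∀ (π : Hash s n) → 0ℚ ≤ collisions w π
0≤collisions {n = n} w 0≤w π = ∫-nonNeg (fins n) (λ i → ∫-nonNeg (fins n) (0≤collisionTerm w 0≤w π i))

𝔼-collisions≤ : ∀ s {n} (w : Fin n → ℚ) → (∀ i → 0ℚ ≤ w i) → 𝔼 (hash s n) (collisions w) ≤ ½ ^ s * (∑ w * ∑ w)
𝔼-collisions≤ s {n} w 0≤w = ≤-trans
  (≤-reflexive (trans (∫-swap ⟦ hash s n ⟧ (fins n) _) (∫-cong (fins n) (λ i → ∫-swap ⟦ hash s n ⟧ (fins n) _))))
  (≤-trans (∫-mono (fins n) (λ i → ∫-mono (fins n) (term i))) (≤-reflexive total))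
  where
  term : ∀ i j → 𝔼 (hash s n) (λ π → collisionTerm w π i j) ≤ (½ ^ s * w i) * w j
  term i j with eqF i j in e
  ... | true  = ≤-trans (≤-reflexive (trans (∫-cong ⟦ hash s n ⟧
      (λ π → solve 2 (λ a b → con 0ℚ :* a :* b := con 0ℚ) refl (w i * w j) (ind (collide π i j))))
                  (∫-0 ⟦ hash s n ⟧))) (0≤* (0≤* (^-nonNeg 0≤½ s) (0≤w i)) (0≤w j))
  ... | false = ≤-reflexive (trans (∫-* ⟦ hash s n ⟧ (1ℚ * (w i * w j)) _)
      (trans (cong (1ℚ * (w i * w j) *_) (𝔼-collide i j i≢j))
                  (solve 3 (λ p a b → con 1ℚ :* (a :* b) :* p := (p :* a) :* b) refl (½ ^ s) (w i) (w j))))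
    where
    i≢j : i ≢ j
    i≢j refl with trans (sym e) (eqF-refl i)
    ... | ()
  total : ∑ (λ i → ∑ (λ j → (½ ^ s * w i) * w j)) ≡ ½ ^ s * (∑ w * ∑ w)
  total = trans (∫-cong (fins n) (λ i → trans (∫-* (fins n) (½ ^ s * w i) w)
       (solve 3 (λ p a b → (p :* a) :* b := (p :* b) :* a) refl (½ ^ s) (w i) (∑ w))))
    (trans (∫-* (fins n) (½ ^ s * ∑ w) w) (*-assoc (½ ^ s) (∑ w) (∑ w)))

bucket : ∀ {s n} → Hash s n → Cube s → Subset n
bucket π v = map (λ u → eqᵇ u v) π

-- the set called G above, as a function of π and B
saturate : ∀ {s n} → Hash s n → Subset n → Subset n
saturate π B = map (λ v → meets B (bucket π v)) π

⊆ᵇ⇒lookup : ∀ {n} (U A : Subset n) j → (U ⊆ᵇ A) ≡ true → lookup U j ≡ true → lookup A j ≡ true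
⊆ᵇ⇒lookup (true ∷ U)  (true ∷ A) zero    e l = refl
⊆ᵇ⇒lookup (true ∷ U)  (true ∷ A) (suc j) e l = ⊆ᵇ⇒lookup U A j e l
⊆ᵇ⇒lookup (false ∷ U) (a ∷ A)    (suc j) e l = ⊆ᵇ⇒lookup U A j e l

lookup⇒⊆ᵇ : ∀ {n} (U A : Subset n) → (∀ j → lookup U j ≡ true → lookup A j ≡ true) → (U ⊆ᵇ A) ≡ true
lookup⇒⊆ᵇ []          []      h = refl
lookup⇒⊆ᵇ (true ∷ U)  (a ∷ A) h rewrite h zero refl = lookup⇒⊆ᵇ U A (λ j → h (suc j))
lookup⇒⊆ᵇ (false ∷ U) (a ∷ A) h = lookup⇒⊆ᵇ U A (λ j → h (suc j))

⊈ᵇ-witness : ∀ {n} (U A : Subset n) → (U ⊆ᵇ A) ≡ false → ∃ λ j → (lookup U j ≡ true) × (lookup A j ≡ false)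
⊈ᵇ-witness []          []          ()
⊈ᵇ-witness (true ∷ U)  (false ∷ A) e = zero , refl , refl
⊈ᵇ-witness (true ∷ U)  (true ∷ A)  e with ⊈ᵇ-witness U A e
... | j , u , a = suc j , u , a
⊈ᵇ-witness (false ∷ U) (_ ∷ A)     e with ⊈ᵇ-witness U A e
... | j , u , a = suc j , u , a

lookup-bucket : ∀ {s n} (π : Hash s n) i j → lookup (bucket π (lookup π j)) i ≡ collide π i j
lookup-bucket π i j = lookup-map i (λ u → eqᵇ u (lookup π j)) π

meets-intro : ∀ {n} (A B : Subset n) i → lookup A i ≡ true → lookup B i ≡ true → meets A B ≡ true
meets-intro (true ∷ A)  (true ∷ B)  zero    a b = refl
meets-intro (true ∷ A)  (true ∷ B)  (suc i) a b = refl
meets-intro (true ∷ A)  (false ∷ B) (suc i) a b = meets-intro A B i a b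
meets-intro (false ∷ A) (_ ∷ B)     (suc i) a b = meets-intro A B i a b

⊆-saturate : ∀ {s n} (π : Hash s n) B → (B ⊆ᵇ saturate π B) ≡ true
⊆-saturate π B = lookup⇒⊆ᵇ B (saturate π B) (λ j e → trans (lookup-map j _ π)
  (meets-intro B _ j e (trans (lookup-bucket π j j) (eqᵇ-refl (lookup π j)))))

-- If U is not inside B, fix one j in U outside B before drawing the hash. For U to lie in the
-- saturation, j must collide with some element of B, and a union bound over B suffices, however
-- large U is.
𝔼-⊆-saturate : ∀ s {n} (U B : Subset n) →
               𝔼 (hash s n) (λ π → ind (U ⊆ᵇ saturate π B)) - ind (U ⊆ᵇ B) ≤ ½ ^ s * ℕ→ℚ (card B)
𝔼-⊆-saturate s {n} U B with U ⊆ᵇ B in e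
... | true  = ≤-trans (+-monoˡ-≤ (- 1ℚ) (≤-trans (∫-mono ⟦ hash s n ⟧ (λ π → ind≤1 (U ⊆ᵇ saturate π B)))
                (≤-reflexive (𝔼-const (hash s n) 1ℚ)))) (0≤* (^-nonNeg 0≤½ s) (0≤ℕ→ℚ (card B)))
... | false with ⊈ᵇ-witness U B e
...   | j , Uj , ¬Bj = ≤-trans (≤-reflexive (+-identityʳ _)) (≤-trans (∫-mono ⟦ hash s n ⟧ bound)
          (≤-trans (≤-reflexive (∫-swap ⟦ hash s n ⟧ (fins n) _)) (≤-trans (∫-mono (fins n) term)
          (≤-reflexive (trans (∫-* (fins n) (½ ^ s) _) (cong (½ ^ s *_) (∑-card B)))))))
  where
  bound : ∀ π → ind (U ⊆ᵇ saturate π B) ≤ ∑ (λ i → ind (collide π i j) * ind (lookup B i))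
  bound π with U ⊆ᵇ saturate π B in U⊆
  ... | false = ∫-nonNeg (fins n) (λ i → 0≤* (0≤ind (collide π i j)) (0≤ind (lookup B i)))
  ... | true  = ≤-trans (≤-reflexive (cong ind (trans (sym (⊆ᵇ⇒lookup U _ j U⊆ Uj)) (lookup-map j _ π))))
                  (≤-trans (meets≤∑ B _) (≤-reflexive (∫-cong (fins n)
                      (λ i → cong (λ b → ind b * ind (lookup B i)) (lookup-bucket π i j)))))
  term : ∀ i → 𝔼 (hash s n) (λ π → ind (collide π i j) * ind (lookup B i)) ≤ ½ ^ s * ind (lookup B i)
  term i with lookup B i in Bi
  ... | false = ≤-reflexive (trans (∫-cong ⟦ hash s n ⟧ (λ π → *-zeroʳ (ind (collide π i j))))
      (trans (∫-0 ⟦ hash s n ⟧) (sym (*-zeroʳ (½ ^ s)))))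
  ... | true  = ≤-reflexive (trans (∫-cong ⟦ hash s n ⟧ (λ π → *-identityʳ (ind (collide π i j))))
      (trans (𝔼-collide i j i≢j) (sym (*-identityʳ (½ ^ s)))))
    where
    i≢j : i ≢ j
    i≢j refl with trans (sym Bi) ¬Bj
    ... | ()

𝔼-weight-saturate : ∀ s {n} (F : Cube n → ℚ) → (∀ x → F x * F x ≡ 1ℚ) → ∀ B →
                    𝔼 (hash s n) (λ π → weight F (saturate π B) - weight F B) ≤ ½ ^ s * ℕ→ℚ (card B)
𝔼-weight-saturate s {n} F e B = ≤-trans (≤-reflexive (trans (∫-sub ⟦ hash s n ⟧ _ _)
     (trans (cong₂ _-_ (∫-swap ⟦ hash s n ⟧ (spec n F) (λ π U → ind (U ⊆ᵇ saturate π B)))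
         (𝔼-const (hash s n) (weight F B)))
       (sym (∫-sub (spec n F) _ _)))))
  (≤-trans (∫-mono (spec n F) (λ U → 𝔼-⊆-saturate s U B))
  (≤-reflexive (trans (∫-const (spec n F) _) (trans (cong (½ ^ s * ℕ→ℚ (card B) *_) (spec-mass n F e))
      (*-identityʳ _)))))

⊆ᵇ-trans-ind : ∀ {n} (U A B : Subset n) → (A ⊆ᵇ B) ≡ true → ind (U ⊆ᵇ A) ≤ ind (U ⊆ᵇ B)
⊆ᵇ-trans-ind U A B A⊆B with U ⊆ᵇ A in e
... | false = 0≤ind (U ⊆ᵇ B)
... | true  = ≤-reflexive (cong ind (sym (lookup⇒⊆ᵇ U B (λ j u → ⊆ᵇ⇒lookup A B j A⊆B (⊆ᵇ⇒lookup U A j e u)))))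

weight-mono : ∀ {n} (F : Cube n → ℚ) A B → (A ⊆ᵇ B) ≡ true → weight F A ≤ weight F B
weight-mono {n} F A B A⊆B = ∫-mono (spec n F) (λ U → ⊆ᵇ-trans-ind U A B A⊆B)

leᵇ : ℚ → ℚ → Bool
leᵇ a b with a ≤? b
... | yes _ = true
... | no  _ = false

leᵇ-true : ∀ {a b} → leᵇ a b ≡ true → a ≤ b
leᵇ-true {a} {b} e with a ≤? b
... | yes a≤b = a≤b

leᵇ-false : ∀ {a b} → leᵇ a b ≡ false → b < a
leᵇ-false {a} {b} e with a ≤? b
... | no a≰b = ≰⇒> a≰b

heavy : ∀ {n} → ℚ → (Fin n → ℚ) → Subset n
heavy τ w = tabulate (λ i → leᵇ τ (w i))

card-heavy : ∀ {n} τ (w : Fin n → ℚ) → (∀ i → 0ℚ ≤ w i) → τ * ℕ→ℚ (card (heavy τ w)) ≤ ∑ w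
card-heavy {n} τ w 0≤w = ≤-trans (≤-reflexive (trans (cong (τ *_) (sym (∑-card (heavy τ w)))) (sym (∫-* (fins n) τ _))))
  (∫-mono (fins n) term)
  where
  term : ∀ i → τ * ind (lookup (heavy τ w) i) ≤ w i
  term i rewrite lookup∘tabulate (λ i → leᵇ τ (w i)) i with τ ≤? w i
  ... | yes τ≤ = ≤-trans (≤-reflexive (*-identityʳ τ)) τ≤
  ... | no  _  = ≤-trans (≤-reflexive (*-zeroʳ τ)) (0≤w i)

-- Expand the square over pairs of members. On the diagonal w_i² ≤ τ w_i, since every member is
-- light; off the diagonal both indices share the bucket, so the product is counted among the
-- collisions.
light-bucket-sq : ∀ {s n} τ (w : Fin n → ℚ) → (∀ i → 0ℚ ≤ w i) → ∀ (π : Hash s n) v →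
                  meets (heavy τ w) (bucket π v) ≡ false →
                  let W = ∑ (λ i → ind (lookup (bucket π v) i) * w i) in W * W ≤ τ * W + collisions w π
light-bucket-sq {s} {n} τ w 0≤w π v light = ≤-trans (≤-reflexive (sym (∫-* (fins n) W a)))
  (≤-trans (∫-mono (fins n) row)
  (≤-reflexive (trans (∫-+ (fins n) _ _) (cong (_+ collisions w π) (∫-* (fins n) τ a)))))
  where
  a : Fin n → ℚ
  a i = ind (lookup (bucket π v) i) * w i
  W = ∑ a
  0≤a : ∀ i → 0ℚ ≤ a i
  0≤a i = 0≤* (0≤ind (lookup (bucket π v) i)) (0≤w i)
  diag : ∀ i → a i * a i ≤ τ * a i
  diag i with lookup (bucket π v) i in b
  ... | false = ≤-reflexive (solve 2 (λ w τ → (con 0ℚ :* w) :* (con 0ℚ :* w) := τ :* (con 0ℚ :* w)) refl (w i) τ)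
  ... | true with leᵇ τ (w i) in d
  ...   | true = ⊥-elim (absurd (trans (sym (meets-intro (heavy τ w) (bucket π v) i (trans (lookup∘tabulate _ i) d) b))
      light))
    where
    absurd : true ≢ false
    absurd ()
  ...   | false = *-monoʳ-≤-nonNeg (1ℚ * w i) {{nonNegative (0≤* (nonNegative⁻¹ 1ℚ) (0≤w i))}}
                     (≤-trans (≤-reflexive (*-identityˡ (w i))) (<⇒≤ (leᵇ-false d)))
  hashed : ∀ k → lookup (bucket π v) k ≡ true → lookup π k ≡ v
  hashed k b = eqᵇ-sound (lookup π k) v (trans (sym (lookup-map k (λ u → eqᵇ u v) π)) b)
  term : ∀ i j → a i * a j ≤ ind (eqF i j) * (τ * a j) + collisionTerm w π i j
  term i j with eqF i j in e
  ... | true with eqF-sound i j e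
  ...   | refl = ≤-trans (diag i) (≤-reflexive (solve 3 (λ x y z → x := con 1ℚ :* x :+ con 0ℚ :* y :* z) refl (τ * a i)
      (w i * w i) (ind (collide π i i))))
  term i j | false with lookup (bucket π v) i in bi | lookup (bucket π v) j in bj
  ... | false | b     = ≤-trans (≤-reflexive (solve 2 (λ x y → con 0ℚ :* x :* y := con 0ℚ) refl (w i) (ind b * w j)))
                          (0≤+ (≤-reflexive (sym (*-zeroˡ (τ * (ind b * w j)))))
                              (0≤* (0≤* (nonNegative⁻¹ 1ℚ) (0≤* (0≤w i) (0≤w j))) (0≤ind (collide π i j))))
  ... | true  | false = ≤-trans (≤-reflexive (solve 2 (λ x y → con 1ℚ :* x :* (con 0ℚ :* y) := con 0ℚ) refl (w i)
      (w j)))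
                          (0≤+ (≤-reflexive (sym (*-zeroˡ (τ * (0ℚ * w j)))))
                              (0≤* (0≤* (nonNegative⁻¹ 1ℚ) (0≤* (0≤w i) (0≤w j))) (0≤ind (collide π i j))))
  ... | true  | true  rewrite hashed i bi | hashed j bj | eqᵇ-refl v = ≤-reflexive
      (solve 3 (λ x y τ → con 1ℚ :* x :* (con 1ℚ :* y) := con 0ℚ :* (τ :* (con 1ℚ :* y)) :+ con 1ℚ :* (x :* y) :* con
          1ℚ) refl (w i) (w j) τ)
  row : ∀ i → W * a i ≤ τ * a i + ∑ (collisionTerm w π i)
  row i = ≤-trans (≤-reflexive (trans (*-comm W (a i)) (sym (∫-* (fins n) (a i) a))))
    (≤-trans (∫-mono (fins n) (term i)) (≤-reflexive (trans (∫-+ (fins n) _ _)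
      (cong (_+ ∑ (collisionTerm w π i)) (∑-eqF i (λ j → τ * a j))))))

-- A bucket of light coordinates has W(W - τ) bounded by the collisions, hence below τ²/16, but W ≥
-- 17τ/16 gives W(W - τ) ≥ 17τ²/256, which is larger.
heavy-bucket : ∀ {s n} τ → 0ℚ < τ → (w : Fin n → ℚ) → (∀ i → 0ℚ ≤ w i) → ∀ (π : Hash s n) v →
               collisions w π < 1/16 * (τ * τ) →
               17/16 * τ ≤ ∑ (λ i → ind (lookup (bucket π v) i) * w i) →
               meets (heavy τ w) (bucket π v) ≡ true
heavy-bucket {s} {n} τ 0<τ w 0≤w π v X< W≥ with meets (heavy τ w) (bucket π v) in light
... | true  = refl
... | false = ⊥-elim (<-irrefl refl (<-≤-trans X< (≤-trans
      (≤-by (1/16 * (1/16 * (τ * τ)) + (17/16 * τ * (W - 17/16 * τ) + (W - τ) * (W - 17/16 * τ)))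
         (0≤+ (0≤* (nonNegative⁻¹ 1/16) (0≤* (nonNegative⁻¹ 1/16) (0≤sq τ)))
            (0≤+ (0≤* (0≤* (nonNegative⁻¹ 17/16) (<⇒≤ 0<τ)) (0≤-diff W≥)) (0≤* (0≤-diff τ≤W) (0≤-diff W≥))))
         (solve 2 (λ W t → W :* W :- t :* W := con 1/16 :* (t :* t) :+ (con 1/16 :* (con 1/16 :* (t :* t))
            :+ (con 17/16 :* t :* (W :- con 17/16 :* t) :+ (W :- t) :* (W :- con 17/16 :* t)))) refl W τ))
      (≤-from-diff (≤-trans (0≤-diff (light-bucket-sq τ w 0≤w π v light))
         (≤-reflexive (solve 3 (λ a b c → a :+ b :- c := b :- (c :- a)) refl (τ * W) (collisions w π) (W * W))))))))
  where
  W = ∑ (λ i → ind (lookup (bucket π v) i) * w i)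
  τ≤W : τ ≤ W
  τ≤W = ≤-trans (≤-by (1/16 * τ) (0≤* (nonNegative⁻¹ 1/16) (<⇒≤ 0<τ))
      (solve 1 (λ t → con 17/16 :* t := t :+ con 1/16 :* t) refl τ)) W≥

-- Sampling and query programs

-- Samples sit at the leaves of a complete binary tree, so a mean is an iterated halving and its
-- analysis an induction on the depth.
Tree : Set → ℕ → Set
Tree X zero    = X
Tree X (suc t) = Tree X t × Tree X t

tree : ∀ {X} → Coin X → ∀ t → Coin (Tree X t)
tree c zero    = c
tree c (suc t) = tree c t >>=ᶜ λ l → tree c t >>=ᶜ λ r → ret (l , r)

mean : ∀ {X : Set} → (X → ℚ) → ∀ t → Tree X t → ℚ
mean v zero    x       = v x
mean v (suc t) (l , r) = ½ * (mean v t l + mean v t r)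

𝔼-mean : ∀ {X} (c : Coin X) v t → 𝔼 (tree c t) (mean v t) ≡ 𝔼 c v
𝔼-mean c v zero    = refl
𝔼-mean c v (suc t) = trans (∫-cong ⟦ tree c t ⟧ (λ l → trans (∫-* ⟦ tree c t ⟧ ½ _)
    (cong (½ *_) (trans (∫-+ ⟦ tree c t ⟧ _ _) (cong₂ _+_ (𝔼-const (tree c t) (mean v t l)) (𝔼-mean c v t))))))
  (trans (∫-* ⟦ tree c t ⟧ ½ _) (trans (cong (½ *_) (trans (∫-+ ⟦ tree c t ⟧ _ _)
     (cong₂ _+_ (𝔼-mean c v t) (𝔼-const (tree c t) (𝔼 c v))))) (½+½ (𝔼 c v))))

-- Each level averages two independent copies; the centred cross term integrates to zero, so the
-- variance halves.
variance-mean : ∀ {X} (c : Coin X) v μ → 𝔼 c v ≡ μ → ∀ t →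
                𝔼 (tree c t) (λ ω → (mean v t ω - μ) * (mean v t ω - μ)) ≡ ½ ^ t * 𝔼 c (λ x → (v x - μ) * (v x - μ))
variance-mean c v μ e zero    = sym (*-identityˡ _)
variance-mean c v μ e (suc t) = trans (∫-cong ⟦ T ⟧ inner) (trans (∫-+ ⟦ T ⟧ _ _)
  (trans (cong₂ _+_ (trans (∫-* ⟦ T ⟧ ¼ _) (cong (¼ *_) ih)) (𝔼-const T _))
    (solve 2 (λ p u → con ¼ :* (p :* u) :+ con ¼ :* (p :* u) := con ½ :* p :* u) refl (½ ^ t) V)))
  where
  T = tree c t
  d : Tree _ t → ℚ
  d ω = mean v t ω - μ
  V = 𝔼 c (λ x → (v x - μ) * (v x - μ))
  ih = variance-mean c v μ e t
  centered : 𝔼 T d ≡ 0ℚ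
  centered = trans (∫-sub ⟦ T ⟧ _ _) (trans (cong₂ _-_ (trans (𝔼-mean c v t) e) (𝔼-const T μ)) (+-inverseʳ μ))
  inner : ∀ l → 𝔼 T (λ r → (½ * (mean v t l + mean v t r) - μ) * (½ * (mean v t l + mean v t r) - μ))
              ≡ ¼ * (d l * d l) + ¼ * (½ ^ t * V)
  inner l = trans (∫-cong ⟦ T ⟧ (λ r → solve 3 (λ a b m → (con ½ :* (a :+ b) :- m) :* (con ½ :* (a :+ b) :- m)
        := con ¼ :* ((a :- m) :* (a :- m)) :+ (con ½ :* (a :- m) :* (b :- m) :+ con ¼ :* ((b :- m) :* (b :- m)))) refl
            (mean v t l) (mean v t r) μ))
    (trans (∫-+ ⟦ T ⟧ (λ _ → ¼ * (d l * d l)) (λ r → ½ * d l * d r + ¼ * (d r * d r)))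
        (cong₂ _+_ (𝔼-const T (¼ * (d l * d l))) (trans (∫-+ ⟦ T ⟧ _ _)
      (trans (cong₂ _+_ (trans (∫-* ⟦ T ⟧ (½ * d l) d) (trans (cong (½ * d l *_) centered) (*-zeroʳ (½ * d l))))
                        (trans (∫-* ⟦ T ⟧ ¼ _) (cong (¼ *_) ih)))
        (+-identityˡ (¼ * (½ ^ t * V)))))))

variance-mean≤ : ∀ {X} (c : Coin X) v μ → 𝔼 c v ≡ μ → ∀ b → (∀ x → v x * v x ≤ b) → ∀ t →
                 𝔼 (tree c t) (λ ω → (mean v t ω - μ) * (mean v t ω - μ)) ≤ ½ ^ t * b
variance-mean≤ c v μ e b v²≤ t = ≤-trans (≤-reflexive (variance-mean c v μ e t))
  (*-mono-nonNeg (½ ^ t) (^-nonNeg 0≤½ t) (≤-trans (≤-reflexive (variance-identity c v μ e))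
  (≤-trans (≤-by (μ * μ) (0≤sq μ) (solve 2 (λ a b → a := a :- b :+ b) refl (𝔼 c (v · v)) (μ * μ)))
  (≤-trans (∫-mono ⟦ c ⟧ v²≤) (≤-reflexive (𝔼-const c b))))))

sq-avg≤ : ∀ {a b m} → a * a ≤ m → b * b ≤ m → (½ * (a + b)) * (½ * (a + b)) ≤ m
sq-avg≤ {a} {b} {m} a²≤ b²≤ = ≤-by (½ * ((m - a * a) + (m - b * b)) + ¼ * ((a - b) * (a - b)))
  (0≤+ (0≤* 0≤½ (0≤+ (0≤-diff a²≤) (0≤-diff b²≤))) (0≤* (nonNegative⁻¹ ¼) (0≤sq (a - b))))
  (solve 3 (λ a b m → m := (con ½ :* (a :+ b)) :* (con ½ :* (a :+ b)) :+
      (con ½ :* ((m :- a :* a) :+ (m :- b :* b)) :+ con ¼ :* ((a :- b) :* (a :- b)))) refl a b m)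

mean-sq≤ : ∀ {X : Set} (v : X → ℚ) b → (∀ x → v x * v x ≤ b) → ∀ t ω → mean v t ω * mean v t ω ≤ b
mean-sq≤ v b v²≤ zero    x       = v²≤ x
mean-sq≤ v b v²≤ (suc t) (l , r) = sq-avg≤ {mean v t l} {mean v t r} (mean-sq≤ v b v²≤ t l) (mean-sq≤ v b v²≤ t r)

a≤∣a∣ : ∀ a → a ≤ ∣ a ∣
a≤∣a∣ a = ≤-trans (≤-reflexive (sym (*-identityˡ a))) (val*≤abs true a)

abs-diff-sq≤ : ∀ a b → (∣ a ∣ - ∣ b ∣) * (∣ a ∣ - ∣ b ∣) ≤ (a - b) * (a - b)
abs-diff-sq≤ a b = ≤-by (2ℚ * (∣ a * b ∣ - a * b)) (0≤* (nonNegative⁻¹ 2ℚ) (0≤-diff (a≤∣a∣ (a * b))))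
  (trans (solve 2 (λ a b → (a :- b) :* (a :- b) := a :* a :+ b :* b :- con 2ℚ :* (a :* b)) refl a b)
  (trans (cong₂ (λ u v → u + v - 2ℚ * (a * b)) (sym (abs-sq a)) (sym (abs-sq b)))
  (trans (solve 3 (λ u v p → u :* u :+ v :* v :- con 2ℚ :* p := (u :- v) :* (u :- v) :+ con 2ℚ :* (u :* v :- p)) refl ∣
      a ∣ ∣ b ∣ (a * b))
    (cong (λ z → (∣ a ∣ - ∣ b ∣) * (∣ a ∣ - ∣ b ∣) + 2ℚ * (z - a * b)) (sym (∣p*q∣≡∣p∣*∣q∣ a b))))))

NormSample : ℕ → ℕ → Set
NormSample n t = Cube n × Tree (Cube n) t

normSample : ∀ n t → Coin (NormSample n t)
normSample n t = cube n >>=ᶜ λ x → tree (cube n) t >>=ᶜ λ ys → ret (x , ys)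

sampleNorm : ∀ {n} t → Subset n → (Cube n → ℚ) → NormSample n t → ℚ
sampleNorm t H F (x , ys) = ∣ mean (λ y → F (merge H x y)) t ys ∣

-- The absolute value of an inner mean is a biased estimate of |proj H F x|. The error is therefore
-- split, at the cost of a factor 2, into the variance of the outer mean and the squared bias. By
-- Jensen and the reverse triangle inequality the latter is at most the inner variance ½^t′.
estimateNorm-error : ∀ {n} t t′ (H : Subset n) F → (∀ x → F x * F x ≡ 1ℚ) →
  let d = λ ω → mean (sampleNorm t′ H F) t ω - norm₁ (proj H F) in
  𝔼 (tree (normSample n t′) t) (d · d) ≤ 2ℚ * (½ ^ t + ½ ^ t′)
estimateNorm-error {n} t t′ H F F²≡1 = ≤-trans (∫-mono ⟦ T ⟧ split)
  (≤-trans (≤-reflexive (trans (∫-* ⟦ T ⟧ 2ℚ _) (cong (2ℚ *_)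
      (trans (∫-+ ⟦ T ⟧ _ _) (cong (𝔼 T (λ ω → (mean v t ω - μ) * (mean v t ω - μ)) +_) (𝔼-const T _))))))
  (*-mono-nonNeg 2ℚ (nonNegative⁻¹ 2ℚ) (+-mono-≤
     (≤-trans (variance-mean≤ (normSample n t′) v μ refl 1ℚ v²≤1 t) (≤-reflexive (*-identityʳ (½ ^ t)))) bias)))
  where
  T = tree (normSample n t′) t
  v = sampleNorm t′ H F
  μ = 𝔼 (normSample n t′) v
  ν = norm₁ (proj H F)
  v²≤1 : ∀ ω → v ω * v ω ≤ 1ℚ
  v²≤1 (x , ys) = ≤-trans (≤-reflexive (abs-sq (mean (λ y → F (merge H x y)) t′ ys)))
      (mean-sq≤ (λ y → F (merge H x y)) 1ℚ (λ y → ≤-reflexive (F²≡1 _)) t′ ys)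
  split : ∀ ω → (mean v t ω - ν) * (mean v t ω - ν) ≤ 2ℚ * ((mean v t ω - μ) * (mean v t ω - μ) + (μ - ν) * (μ - ν))
  split ω = ≤-by ((m - μ - (μ - ν)) * (m - μ - (μ - ν))) (0≤sq (m - μ - (μ - ν)))
     (solve 3 (λ m μ ν → con 2ℚ :* ((m :- μ) :* (m :- μ) :+ (μ :- ν) :* (μ :- ν)) :=
         (m :- ν) :* (m :- ν) :+ (m :- μ :- (μ :- ν)) :* (m :- μ :- (μ :- ν))) refl m μ ν)
    where m = mean v t ω
  d : NormSample n t′ → ℚ
  d (x , ys) = v (x , ys) - ∣ proj H F x ∣
  𝔼d : 𝔼 (normSample n t′) d ≡ μ - ν
  𝔼d = trans (∫-sub ⟦ normSample n t′ ⟧ _ _) (cong (λ z → μ - z)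
      (∫-cong ⟦ cube n ⟧ (λ x → 𝔼-const (tree (cube n) t′) ∣ proj H F x ∣)))
  bias : (μ - ν) * (μ - ν) ≤ ½ ^ t′
  bias = ≤-trans (≤-reflexive (cong₂ _*_ (sym 𝔼d) (sym 𝔼d))) (≤-trans (jensen-sq (normSample n t′) d)
    (≤-trans (∫-mono ⟦ cube n ⟧ (λ x → ≤-trans
       (∫-mono ⟦ tree (cube n) t′ ⟧ (λ ys → abs-diff-sq≤ (mean (λ y → F (merge H x y)) t′ ys) (proj H F x)))
       (variance-mean≤ (cube n) (λ y → F (merge H x y)) (proj H F x) (𝔼-merge H F x) 1ℚ (λ y → ≤-reflexive (F²≡1 _))
           t′)))
    (≤-reflexive (trans (𝔼-const (cube n) (½ ^ t′ * 1ℚ)) (*-identityʳ (½ ^ t′))))))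

-- There is no coin node: no random draw depends on an answer, so all randomness is fixed beforehand
-- and runs are deterministic functions of it.
data Query (n : ℕ) (X : Set) : Set where
  return : X → Query n X
  ask    : Cube n → (Bool → Query n X) → Query n X

_>>=Q_ : ∀ {n X Y} → Query n X → (X → Query n Y) → Query n Y
return x >>=Q g = g x
ask x k  >>=Q g = ask x (λ b → k b >>=Q g)

infixl 1 _>>=Q_

run : ∀ {n X} → BoolFn n → Query n X → X
run f (return x) = x
run f (ask x k)  = run f (k (f x))

run-bind : ∀ {n X Y} (f : BoolFn n) (q : Query n X) (g : X → Query n Y) → run f (q >>=Q g) ≡ run f (g (run f q))
run-bind f (return x) g = refl
run-bind f (ask x k)  g = run-bind f (k (f x)) g

cost : ∀ {n X} → Query n X → ℕ
cost (return x) = 0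
cost (ask x k)  = suc (cost (k true) ℕ.⊔ cost (k false))

cost-bind : ∀ {n X Y} (q : Query n X) (g : X → Query n Y) c → (∀ x → cost (g x) ℕ.≤ c) → cost (q >>=Q g) ℕ.≤ cost q ℕ.+
    c
cost-bind (return x) g c h = h x
cost-bind (ask x k)  g c h = ℕ.s≤s (ℕₚ.⊔-lub
  (ℕₚ.≤-trans (cost-bind (k true) g c h) (ℕₚ.+-monoˡ-≤ c (ℕₚ.m≤m⊔n (cost (k true)) (cost (k false)))))
  (ℕₚ.≤-trans (cost-bind (k false) g c h) (ℕₚ.+-monoˡ-≤ c (ℕₚ.m≤n⊔m (cost (k true)) (cost (k false))))))

meanQ : ∀ {n} {X : Set} → (X → Query n ℚ) → ∀ t → Tree X t → Query n ℚ
meanQ q zero    x       = q x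
meanQ q (suc t) (l , r) = meanQ q t l >>=Q λ a → meanQ q t r >>=Q λ b → return (½ * (a + b))

run-meanQ : ∀ {n} {X : Set} (f : BoolFn n) (q : X → Query n ℚ) v → (∀ x → run f (q x) ≡ v x) → ∀ t ω →
            run f (meanQ q t ω) ≡ mean v t ω
run-meanQ f q v e zero    x       = e x
run-meanQ f q v e (suc t) (l , r) = trans (run-bind f (meanQ q t l) _) (trans (run-bind f (meanQ q t r) _)
  (cong₂ (λ a b → ½ * (a + b)) (run-meanQ f q v e t l) (run-meanQ f q v e t r)))

double : ∀ t c → 2 ℕ.^ suc t ℕ.* c ≡ 2 ℕ.^ t ℕ.* c ℕ.+ 2 ℕ.^ t ℕ.* c
double t c = trans (ℕₚ.*-assoc 2 (2 ℕ.^ t) c) (cong (2 ℕ.^ t ℕ.* c ℕ.+_) (ℕₚ.+-identityʳ (2 ℕ.^ t ℕ.* c)))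

cost-meanQ : ∀ {n} {X : Set} (q : X → Query n ℚ) c → (∀ x → cost (q x) ℕ.≤ c) → ∀ t ω → cost (meanQ q t ω) ℕ.≤ 2 ℕ.^ t
    ℕ.* c
cost-meanQ q c h zero    x       = ℕₚ.≤-trans (h x) (ℕₚ.≤-reflexive (sym (ℕₚ.*-identityˡ c)))
cost-meanQ q c h (suc t) (l , r) = ℕₚ.≤-trans
  (cost-bind (meanQ q t l) _ (2 ℕ.^ t ℕ.* c) (λ a → ℕₚ.≤-trans (cost-bind (meanQ q t r) _ 0 (λ _ → ℕ.z≤n))
     (ℕₚ.≤-trans (ℕₚ.≤-reflexive (ℕₚ.+-identityʳ _)) (cost-meanQ q c h t r))))
  (ℕₚ.≤-trans (ℕₚ.+-monoˡ-≤ _ (cost-meanQ q c h t l)) (ℕₚ.≤-reflexive (sym (double t c))))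

joinTable : ∀ {Y : Set} {s} → (Cube s → Y) → (Cube s → Y) → Cube (suc s) → Y
joinTable g h (b ∷ v) = if b then g v else h v

-- Decisions are made once per bucket and looked up for each coordinate afterwards, which keeps `n`
-- out of the cost.
tableQ : ∀ {n} {Y : Set} s → (Cube s → Query n Y) → Query n (Cube s → Y)
tableQ zero    q = q [] >>=Q λ y → return (λ _ → y)
tableQ (suc s) q = tableQ s (λ v → q (true ∷ v)) >>=Q λ g → tableQ s (λ v → q (false ∷ v)) >>=Q λ h →
                   return (joinTable g h)

run-tableQ : ∀ {n} {Y : Set} (f : BoolFn n) s (q : Cube s → Query n Y) v → run f (tableQ s q) v ≡ run f (q v)
run-tableQ f zero    q []      = cong (λ g → g []) (run-bind f (q []) (λ y → return (λ _ → y)))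
run-tableQ f (suc s) q (b ∷ v) = trans (cong (λ g → g (b ∷ v)) (trans
    (run-bind f (tableQ s (λ v → q (true ∷ v))) (λ g → tableQ s (λ v → q (false ∷ v)) >>=Q λ h → return
        (joinTable g h)))
    (run-bind f (tableQ s (λ v → q (false ∷ v))) (λ h → return (joinTable _ h))))) (choose b)
  where
  choose : ∀ b → (if b then run f (tableQ s (λ v → q (true ∷ v))) v else run f (tableQ s (λ v → q (false ∷ v))) v) ≡ run
      f (q (b ∷ v))
  choose true  = run-tableQ f s (λ v → q (true ∷ v)) v
  choose false = run-tableQ f s (λ v → q (false ∷ v)) v

cost-tableQ : ∀ {n} {Y : Set} s (q : Cube s → Query n Y) c → (∀ v → cost (q v) ℕ.≤ c) → cost (tableQ s q) ℕ.≤ 2 ℕ.^ s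
    ℕ.* c
cost-tableQ zero    q c h = ℕₚ.≤-trans (cost-bind (q []) _ 0 (λ _ → ℕ.z≤n)) (ℕₚ.+-mono-≤ (h []) ℕ.z≤n)
cost-tableQ (suc s) q c h = ℕₚ.≤-trans
  (cost-bind (tableQ s (λ v → q (true ∷ v))) _ (2 ℕ.^ s ℕ.* c)
      (λ g → ℕₚ.≤-trans (cost-bind (tableQ s (λ v → q (false ∷ v))) _ 0 (λ _ → ℕ.z≤n))
     (ℕₚ.≤-trans (ℕₚ.≤-reflexive (ℕₚ.+-identityʳ _)) (cost-tableQ s _ c (λ v → h (false ∷ v))))))
  (ℕₚ.≤-trans (ℕₚ.+-monoˡ-≤ _ (cost-tableQ s _ c (λ v → h (true ∷ v)))) (ℕₚ.≤-reflexive (sym (double s c))))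

toAlg : ∀ {n} → Query n ℚ → Alg n
toAlg (return q) = out q
toAlg (ask x k)  = ask x (λ b → toAlg (k b))

queries-toAlg : ∀ {n} (q : Query n ℚ) → queries (toAlg q) ≡ cost q
queries-toAlg (return x) = refl
queries-toAlg (ask x k)  = cong₂ (λ a b → suc (a ℕ.⊔ b)) (queries-toAlg (k true)) (queries-toAlg (k false))

flips : ∀ {n X} → Coin X → (X → Alg n) → Alg n
flips (ret x)    k = k x
flips bit        k = coin k
flips (c >>=ᶜ g) k = flips c (λ x → flips (g x) k)

queries-flips : ∀ {n X} (co : Coin X) (k : X → Alg n) c → (∀ x → queries (k x) ℕ.≤ c) → queries (flips co k) ℕ.≤ c
queries-flips (ret x)    k c h = h x
queries-flips bit        k c h = ℕₚ.⊔-lub (h true) (h false)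
queries-flips (co >>=ᶜ g) k c h = queries-flips co _ c (λ x → queries-flips (g x) k c h)

module _ {n : ℕ} (f : BoolFn n) (P : ℚ → Set) where

  PrAtLeast-flips : ∀ {X} (co : Coin X) (k : X → Alg n) v → (∀ x → PrAtLeast f P (k x) (v x)) →
                    PrAtLeast f P (flips co k) (𝔼 co v)
  PrAtLeast-flips (ret x)     k v h = h x
  PrAtLeast-flips bit         k v h = coin (h true) (h false) ≤-refl
  PrAtLeast-flips (co >>=ᶜ g) k v h = PrAtLeast-flips co _ _ (λ x → PrAtLeast-flips (g x) k v h)

  PrAtLeast-toAlg : ∀ (q : Query n ℚ) {p} → P (run f q) → p ≤ 1ℚ → PrAtLeast f P (toAlg q) p
  PrAtLeast-toAlg (return x) h p≤1 = hit h p≤1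
  PrAtLeast-toAlg (ask x k)  h p≤1 = ask (PrAtLeast-toAlg (k (f x)) h p≤1)

  PrAtLeast-weaken : ∀ {A p p′} → p ≤ p′ → PrAtLeast f P A p′ → PrAtLeast f P A p
  PrAtLeast-weaken le (triv h)     = triv (≤-trans le h)
  PrAtLeast-weaken le (hit h l)    = hit h (≤-trans le l)
  PrAtLeast-weaken le (ask h)      = ask (PrAtLeast-weaken le h)
  PrAtLeast-weaken le (coin a b l) = coin a b (≤-trans le l)

  -- Markov's inequality seed by seed: 1 - Z is at most 1 on a good seed, and where Z ≥ 1 it is at
  -- most 0, so `triv` applies. Success itself never has to be decided.
  PrAtLeast-markov : ∀ {X} (co : Coin X) (q : X → Query n ℚ) (Z : X → ℚ) → (∀ x → 0ℚ ≤ Z x) →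
                     (∀ x → Z x < 1ℚ → P (run f (q x))) →
                     PrAtLeast f P (flips co (λ x → toAlg (q x))) (1ℚ - 𝔼 co Z)
  PrAtLeast-markov co q Z 0≤Z good = PrAtLeast-weaken
    (≤-reflexive (sym (trans (∫-sub ⟦ co ⟧ _ _) (cong (_- 𝔼 co Z) (𝔼-const co 1ℚ)))))
    (PrAtLeast-flips co _ (λ x → 1ℚ - Z x) step)
    where
    step : ∀ x → PrAtLeast f P (toAlg (q x)) (1ℚ - Z x)
    step x with Z x <? 1ℚ
    ... | yes Z<1 = PrAtLeast-toAlg (q x) (good x Z<1) (≤-by (Z x) (0≤Z x)
        (solve 1 (λ z → con 1ℚ := con 1ℚ :- z :+ z) refl (Z x)))
    ... | no  Z≮1 = triv (≤-trans (+-monoʳ-≤ 1ℚ (neg-antimono-≤ (≮⇒≥ Z≮1))) (≤-reflexive (+-inverseʳ 1ℚ)))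

-- The estimation procedure

-- noise: each coordinate is kept with probability 1 - ½^noise; hashBits: log₂ of the number of buckets;
-- the other fields are log₂ of sample sizes
record Sizes : Set where
  field
    noise hashBits influenceBits outerBits innerBits : ℕ

module Procedure (n : ℕ) (sz : Sizes) where
  open Sizes sz

  -- All buckets share one family of influence samples; this is harmless because only the expected
  -- total of their squared errors is used. The samples for the norm are separate, so the selected
  -- set counts as fixed when they are averaged.
  Seed : Set
  Seed = Hash hashBits n × Tree (Sample n) influenceBits × Tree (NormSample n innerBits) outerBits

  seed : Coin Seed
  seed = hash hashBits n >>=ᶜ λ π → tree (sample noise n) influenceBits >>=ᶜ λ ω →
         tree (normSample n innerBits) outerBits >>=ᶜ λ ω′ → ret (π , ω , ω′)

  sampleInfluenceQ : Subset n → Sample n → Query n ℚ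
  sampleInfluenceQ B (R , x , y) =
    ask x λ a → ask (merge R x y) λ b → ask (merge (R ∖ B) x y) λ c → return (val a * (val b - val c))

  selectQ : ℚ → Hash hashBits n → Tree (Sample n) influenceBits → Cube hashBits → Query n Bool
  selectQ θ π ω v = meanQ (sampleInfluenceQ (bucket π v)) influenceBits ω >>=Q λ e → return (leᵇ θ e)

  pointQ : Subset n → Cube n → Cube n → Query n ℚ
  pointQ H x y = ask (merge H x y) λ b → return (val b)

  sampleNormQ : Subset n → NormSample n innerBits → Query n ℚ
  sampleNormQ H (x , ys) = meanQ (pointQ H x) innerBits ys >>=Q λ a → return ∣ a ∣

  finalQ : ℚ → Subset n → Tree (NormSample n innerBits) outerBits → Query n ℚ
  finalQ shift H ω′ = meanQ (sampleNormQ H) outerBits ω′ >>=Q λ q → return (q + shift)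

  estimateQ : ℚ → ℚ → Seed → Query n ℚ
  estimateQ θ shift (π , ω , ω′) = tableQ hashBits (selectQ θ π ω) >>=Q λ sel → finalQ shift (map sel π) ω′

  estimatedInfluence : (Cube n → ℚ) → Hash hashBits n → Tree (Sample n) influenceBits → Cube hashBits → ℚ
  estimatedInfluence F π ω v = mean (sampleInfluence F (bucket π v)) influenceBits ω

  selected : ℚ → (Cube n → ℚ) → Hash hashBits n → Tree (Sample n) influenceBits → Subset n
  selected θ F π ω = map (λ v → leᵇ θ (estimatedInfluence F π ω v)) π

  estimatedNorm : Subset n → (Cube n → ℚ) → Tree (NormSample n innerBits) outerBits → ℚ
  estimatedNorm H F = mean (sampleNorm innerBits H F) outerBits

  run-estimateQ : ∀ f θ shift π ω ω′ → run f (estimateQ θ shift (π , ω , ω′))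
                  ≡ estimatedNorm (selected θ ⟨ f ⟩ π ω) ⟨ f ⟩ ω′ + shift
  run-estimateQ f θ shift π ω ω′ = trans (run-bind f (tableQ hashBits (selectQ θ π ω))
      (λ sel → finalQ shift (map sel π) ω′))
    (trans (cong (λ H → run f (finalQ shift H ω′)) (map-cong (λ v → trans (run-tableQ f hashBits (selectQ θ π ω) v)
        (select v)) π))
    (trans (run-bind f (meanQ (sampleNormQ H) outerBits ω′) (λ q → return (q + shift)))
      (cong (_+ shift) (run-meanQ f (sampleNormQ H) (sampleNorm innerBits H ⟨ f ⟩) norm outerBits ω′))))
    where
    H = selected θ ⟨ f ⟩ π ω
    select : ∀ v → run f (selectQ θ π ω v) ≡ leᵇ θ (estimatedInfluence ⟨ f ⟩ π ω v)
    select v = trans (run-bind f (meanQ (sampleInfluenceQ (bucket π v)) influenceBits ω) (λ e → return (leᵇ θ e)))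
      (cong (leᵇ θ) (run-meanQ f (sampleInfluenceQ (bucket π v)) (sampleInfluence ⟨ f ⟩ (bucket π v)) (λ _ → refl)
          influenceBits ω))
    norm : ∀ ω → run f (sampleNormQ H ω) ≡ sampleNorm innerBits H ⟨ f ⟩ ω
    norm (x , ys) = trans (run-bind f (meanQ (pointQ H x) innerBits ys) (λ a → return ∣ a ∣))
      (cong ∣_∣ (run-meanQ f (pointQ H x) (λ y → ⟨ f ⟩ (merge H x y)) (λ _ → refl) innerBits ys))

  cost-estimateQ : ∀ θ shift ω → cost (estimateQ θ shift ω)
                   ℕ.≤ 2 ℕ.^ hashBits ℕ.* (2 ℕ.^ influenceBits ℕ.* 3 ℕ.+ 0) ℕ.+
                       (2 ℕ.^ outerBits ℕ.* (2 ℕ.^ innerBits ℕ.* 1 ℕ.+ 0) ℕ.+ 0)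
  cost-estimateQ θ shift (π , ω , ω′) = ℕₚ.≤-trans
    (cost-bind (tableQ hashBits (selectQ θ π ω)) _ _ λ sel → finalCost (map sel π))
    (ℕₚ.+-monoˡ-≤ _ (cost-tableQ hashBits (selectQ θ π ω) _ selectCost))
    where
    selectCost : ∀ v → cost (selectQ θ π ω v) ℕ.≤ 2 ℕ.^ influenceBits ℕ.* 3 ℕ.+ 0
    selectCost v = ℕₚ.≤-trans (cost-bind (meanQ (sampleInfluenceQ (bucket π v)) influenceBits ω) _ 0 (λ _ → ℕ.z≤n))
      (ℕₚ.+-monoˡ-≤ 0 (cost-meanQ (sampleInfluenceQ (bucket π v)) 3 (λ _ → ℕₚ.≤-refl) influenceBits ω))
    normCost : ∀ H x → cost (sampleNormQ H x) ℕ.≤ 2 ℕ.^ innerBits ℕ.* 1 ℕ.+ 0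
    normCost H (x , ys) = ℕₚ.≤-trans (cost-bind (meanQ (pointQ H x) innerBits ys) _ 0 (λ _ → ℕ.z≤n))
      (ℕₚ.+-monoˡ-≤ 0 (cost-meanQ (pointQ H x) 1 (λ _ → ℕₚ.≤-refl) innerBits ys))
    finalCost : ∀ H → cost (finalQ shift H ω′) ℕ.≤ 2 ℕ.^ outerBits ℕ.* (2 ℕ.^ innerBits ℕ.* 1 ℕ.+ 0) ℕ.+ 0
    finalCost H = ℕₚ.≤-trans (cost-bind (meanQ (sampleNormQ H) outerBits ω′) _ 0 (λ _ → ℕ.z≤n))
      (ℕₚ.+-monoˡ-≤ 0 (cost-meanQ (sampleNormQ H) _ (normCost H) outerBits ω′))

-- Correctness of the estimate

abs-bounds : ∀ x {r} → 0ℚ ≤ r → x * x ≤ r * r → (x ≤ r) × (- r ≤ x)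
abs-bounds x {r} 0≤r x²≤ = upper x x²≤ ,
  ≤-from-diff (≤-trans (0≤-diff (upper (- x) (≤-trans (≤-reflexive (solve 1 (λ x → (:- x) :* (:- x) := x :* x) refl x))
      x²≤)))
    (≤-reflexive (solve 2 (λ x r → r :- (:- x) := x :- (:- r)) refl x r)))
  where
  upper : ∀ x → x * x ≤ r * r → x ≤ r
  upper x x²≤ with x ≤? r
  ... | yes x≤r = x≤r
  ... | no x≰r  = ⊥-elim (<-irrefl refl (<-≤-trans (≰⇒> x≰r) (*-cancel-pos x (≤-<-trans 0≤r (≰⇒> x≰r))
                    (≤-trans x²≤ (*-monoʳ-≤-nonNeg r {{nonNegative 0≤r}} (<⇒≤ (≰⇒> x≰r)))))))

card-⊆ᵇ : ∀ {n} (U A : Subset n) → (U ⊆ᵇ A) ≡ true → card U ℕ.≤ card A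
card-⊆ᵇ []          []          e = ℕ.z≤n
card-⊆ᵇ (true ∷ U)  (true ∷ A)  e = ℕ.s≤s (card-⊆ᵇ U A e)
card-⊆ᵇ (false ∷ U) (true ∷ A)  e = ℕₚ.m≤n⇒m≤1+n (card-⊆ᵇ U A e)
card-⊆ᵇ (false ∷ U) (false ∷ A) e = card-⊆ᵇ U A e

∖-⊆ : ∀ {n} (A B : Subset n) → ((A ∖ B) ⊆ᵇ A) ≡ true
∖-⊆ []          []          = refl
∖-⊆ (true ∷ A)  (true ∷ B)  = ∖-⊆ A B
∖-⊆ (true ∷ A)  (false ∷ B) = ∖-⊆ A B
∖-⊆ (false ∷ A) (_ ∷ B)     = ∖-⊆ A B

∖∖-⊆ : ∀ {n} (A B : Subset n) → ((A ∖ (A ∖ B)) ⊆ᵇ B) ≡ true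
∖∖-⊆ []          []          = refl
∖∖-⊆ (true ∷ A)  (true ∷ B)  = ∖∖-⊆ A B
∖∖-⊆ (true ∷ A)  (false ∷ B) = ∖∖-⊆ A B
∖∖-⊆ (false ∷ A) (_ ∷ B)     = ∖∖-⊆ A B

-- The twofold difference is T ∩ H. The lost mass sits on sets U ⊆ T, of size at most k, that meet
-- the part of T outside H. There the discount is at least r^k, so r^k times the loss is below the
-- influence of that part, and subadditivity leaves at most k terms bounded by b.
weight-loss : ∀ {n} r → 0ℚ ≤ r → r ≤ 1ℚ → ∀ (F : Cube n → ℚ) k (T H : Subset n) → card T ℕ.≤ k → ∀ b → 0ℚ ≤ b →
              (∀ i → lookup H i ≡ false → coordInfluence r F i ≤ b) →
              r ^ k * (weight F T - weight F (T ∖ (T ∖ H))) ≤ ℕ→ℚ k * b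
weight-loss {n} r 0≤r r≤1 F k T H T≤k b 0≤b small = ≤-trans
  (≤-reflexive (trans (cong (r ^ k *_) (weight-∖ F T C)) (sym (∫-* (spec n F) (r ^ k) _))))
  (≤-trans (∫-mono (spec n F) attenuate) (≤-trans (influence≤∑ r 0≤r F C) (≤-trans (∫-mono (fins n) term)
  (≤-trans (≤-reflexive (trans (∫-* (fins n) b _) (cong (b *_) (∑-card T))))
  (≤-trans (*-mono-nonNeg b 0≤b (ℕ→ℚ-mono T≤k)) (≤-reflexive (*-comm b (ℕ→ℚ k))))))))
  where
  C = T ∖ H
  attenuate : ∀ U → r ^ k * (ind (U ⊆ᵇ T) * ind (meets U C)) ≤ ind (meets U C) * r ^ card U
  attenuate U with U ⊆ᵇ T in e
  ... | false = ≤-trans (≤-reflexive (solve 2 (λ p m → p :* (con 0ℚ :* m) := con 0ℚ) refl (r ^ k) (ind (meets U C))))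
                  (0≤* (0≤ind (meets U C)) (^-nonNeg 0≤r (card U)))
  ... | true  = ≤-trans (≤-reflexive (solve 2 (λ p m → p :* (con 1ℚ :* m) := m :* p) refl (r ^ k) (ind (meets U C))))
                  (*-mono-nonNeg (ind (meets U C)) (0≤ind (meets U C))
                      (^-antitone 0≤r r≤1 (ℕₚ.≤-trans (card-⊆ᵇ U T e) T≤k)))
  term : ∀ i → ind (lookup C i) * coordInfluence r F i ≤ b * ind (lookup T i)
  term i rewrite lookup-zipWith (λ a b → a ∧ not b) i T H with lookup T i | lookup H i in Hi
  ... | false | _     = ≤-reflexive (trans (*-zeroˡ (coordInfluence r F i)) (sym (*-zeroʳ b)))
  ... | true  | true  = ≤-trans (≤-reflexive (*-zeroˡ (coordInfluence r F i))) (0≤* 0≤b (nonNegative⁻¹ 1ℚ))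
  ... | true  | false = ≤-trans (≤-reflexive (*-identityˡ (coordInfluence r F i)))
      (≤-trans (small i Hi) (≤-reflexive (sym (*-identityʳ b))))

½^-pos : ∀ s → 0ℚ < ½ ^ s
½^-pos zero    = positive⁻¹ 1ℚ
½^-pos (suc s) = ≤-<-trans (≤-reflexive (sym (*-zeroʳ ½))) (*-monoʳ-<-pos ½ (½^-pos s))

-- Used in place of a union bound over buckets: a small average of squared errors makes every single
-- error small.
point≤ : ∀ s v (h : Cube s → ℚ) → (∀ v → 0ℚ ≤ h v) → ½ ^ s * h v ≤ 𝔼 (cube s) h
point≤ zero    []      h 0≤h = ≤-reflexive (*-identityˡ (h []))
point≤ (suc s) (b ∷ v) h 0≤h = ≤-trans (≤-reflexive (*-assoc ½ (½ ^ s) (h (b ∷ v))))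
  (*-mono-nonNeg ½ 0≤½ (≤-trans (point≤ s v (λ v → h (b ∷ v)) (λ v → 0≤h _)) (side b)))
  where
  0≤part : ∀ b → 0ℚ ≤ 𝔼 (cube s) (λ v → h (b ∷ v))
  0≤part b = ∫-nonNeg ⟦ cube s ⟧ (λ v → 0≤h _)
  side : ∀ b → 𝔼 (cube s) (λ v → h (b ∷ v)) ≤ 𝔼 (cube s) (λ v → h (true ∷ v)) + 𝔼 (cube s) (λ v → h (false ∷ v))
  side true  = ≤-by _ (0≤part false) refl
  side false = ≤-by _ (0≤part true) (+-comm (𝔼 (cube s) (λ v → h (true ∷ v))) _)

-- The hypotheses are cross-multiplied. `D≤` reads D/τ ≤ k²/ε² and bounds the number of heavy
-- coordinates. `τ≤` says that k coordinates of influence at most 9τ/8 account for mass at most 3ε²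
-- once the discount is undone.
module Correctness (n k : ℕ) (ε : ℚ) .{{pos : Positive ε}} (f : BoolFn n) (sz : Sizes) (τ D : ℚ)
  (0<τ : 0ℚ < τ) (0<ρ^k : 0ℚ < ρ (Sizes.noise sz) ^ k)
  (mρ^m≤D : ∀ m → ℕ→ℚ m * ρ (Sizes.noise sz) ^ m ≤ D)
  (D≤ : D * (ε * ε) ≤ τ * (ℕ→ℚ k * ℕ→ℚ k))
  (τ≤ : ℕ→ℚ k * (9/8 * τ) ≤ ρ (Sizes.noise sz) ^ k * (3ℚ * (ε * ε))) where
  open Sizes sz
  open Procedure n sz

  F = ⟨ f ⟩
  r = ρ noise
  w : Fin n → ℚ
  w = coordInfluence r F
  B = heavy τ w
  -- The midpoint of 17τ/16 and 9τ/8: with estimates accurate to τ/32, a selected bucket has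
  -- influence at least 17τ/16 and an unselected one at most 9τ/8.
  θ = 35/32 * τ

  F²≡1 : ∀ x → F x * F x ≡ 1ℚ
  F²≡1 x = val²≡1 (f x)

  0<ε : 0ℚ < ε
  0<ε = positive⁻¹ ε

  0≤w : ∀ i → 0ℚ ≤ w i
  0≤w = 0≤coordInfluence r (0≤ρ noise) F

  ∑w≤D : ∑ w ≤ D
  ∑w≤D = ∑-coordInfluence≤ r D mρ^m≤D F F²≡1

  card-heavy≤k²/ε² : ℕ→ℚ (card B) ≤ k²/ε² k ε
  card-heavy≤k²/ε² = ≤-trans (≤-reflexive (sym (trans
       (solve 3 (λ c e i → c :* (e :* e) :* (i :* i) := c :* ((e :* i) :* (e :* i))) refl (ℕ→ℚ (card B)) ε i)
       (trans (cong (λ z → ℕ→ℚ (card B) * (z * z)) (*-inverseʳ ε {{nz}})) (*-identityʳ (ℕ→ℚ (card B)))))))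
    (≤-trans (*-monoʳ-≤-nonNeg (i * i) {{nonNegative (0≤sq i)}} scaled)
      (≤-reflexive (solve 2 (λ k i → k :* k :* (i :* i) := (k :* i) :* (k :* i)) refl (ℕ→ℚ k) i)))
    where
    nz = pos⇒nonZero ε
    i = (1/ ε) {{nz}}
    scaled : ℕ→ℚ (card B) * (ε * ε) ≤ ℕ→ℚ k * ℕ→ℚ k
    scaled = *-cancel-pos τ 0<τ (≤-trans (≤-reflexive (sym (*-assoc τ (ℕ→ℚ (card B)) (ε * ε))))
      (≤-trans (*-monoʳ-≤-nonNeg (ε * ε) {{nonNegative (0≤sq ε)}} (≤-trans (card-heavy τ w 0≤w) ∑w≤D)) D≤))

  influenceError² : Hash hashBits n → Tree (Sample n) influenceBits → Cube hashBits → ℚ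
  influenceError² π ω v = let e = estimatedInfluence F π ω v - influence r F (bucket π v) in e * e

  normError² : Subset n → Tree (NormSample n innerBits) outerBits → ℚ
  normError² H ω′ = let e = estimatedNorm H F ω′ - norm₁ (proj H F) in e * e

  module Good (π : Hash hashBits n) (ω : Tree (Sample n) influenceBits) (ω′ : Tree (NormSample n innerBits) outerBits)
    (X< : collisions w π < 1/16 * (τ * τ))
    (Y≤ : weight F (saturate π B) - weight F B ≤ (1/8 * ε) * (1/8 * ε))
    (err≤ : ∀ v → influenceError² π ω v ≤ (1/32 * τ) * (1/32 * τ))
    (normErr≤ : normError² (selected θ F π ω) ω′ ≤ (1/16 * ε) * (1/16 * ε)) where

    H = selected θ F π ω

    0≤1/32τ : 0ℚ ≤ 1/32 * τ
    0≤1/32τ = 0≤* (nonNegative⁻¹ 1/32) (<⇒≤ 0<τ)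

    lookup-selected : ∀ i → lookup H i ≡ leᵇ θ (estimatedInfluence F π ω (lookup π i))
    lookup-selected i = lookup-map i _ π

    H⊆saturate : (H ⊆ᵇ saturate π B) ≡ true
    H⊆saturate = lookup⇒⊆ᵇ H (saturate π B) λ i Hi → trans (lookup-map i _ π)
      (heavy-bucket τ 0<τ w 0≤w π (lookup π i) X< (≤-trans (big (lookup π i)
          (leᵇ-true (trans (sym (lookup-selected i)) Hi)))
        (influence≤∑ r (0≤ρ noise) F (bucket π (lookup π i)))))
      where
      big : ∀ v → θ ≤ estimatedInfluence F π ω v → 17/16 * τ ≤ influence r F (bucket π v)
      big v θ≤ = ≤-by ((1/32 * τ - (e - I)) + (e - θ)) (0≤+ (0≤-diff (proj₁ (abs-bounds (e - I) 0≤1/32τ (err≤ v))))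
          (0≤-diff θ≤))
        (solve 3 (λ e I t → I := con 17/16 :* t :+ ((con 1/32 :* t :- (e :- I)) :+ (e :- con 35/32 :* t))) refl e I τ)
        where
        e = estimatedInfluence F π ω v
        I = influence r F (bucket π v)

    unselected-light : ∀ i → lookup H i ≡ false → w i ≤ 9/8 * τ
    unselected-light i Hi = ≤-trans (coordInfluence≤ r (0≤ρ noise) F (bucket π v) i
        (trans (lookup-bucket π i i) (eqᵇ-refl v)))
      (≤-by ((e - I) - - (1/32 * τ) + (θ - e)) (0≤+ (0≤-diff (proj₂ (abs-bounds (e - I) 0≤1/32τ (err≤ v))))
           (0≤-diff (<⇒≤ (leᵇ-false (trans (sym (lookup-selected i)) Hi)))))
        (solve 3 (λ e I t → con 9/8 :* t := I :+ ((e :- I) :- (:- (con 1/32 :* t)) :+ (con 35/32 :* t :- e))) refl e I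
            τ))
      where
      v = lookup π i
      e = estimatedInfluence F π ω v
      I = influence r F (bucket π v)

    lower : ∀ T → card T ℕ.≤ k → norm₁ (proj T F) ≤ norm₁ (proj H F) + 7/4 * ε
    lower T T≤k = ≤-trans
      (norm₁-proj-close (T ∖ (T ∖ H)) T (∖-⊆ T (T ∖ H)) F (7/4 * ε) 0<7/4ε (≤-trans loss
         -- 7/4 is a rational upper bound for the root of 3, since 49/16 = 3 + 1/16.
         (≤-by (1/16 * (ε * ε)) (0≤* (nonNegative⁻¹ 1/16) (0≤sq ε))
           (solve 1 (λ e → con 7/4 :* e :* (con 7/4 :* e) := con 3ℚ :* (e :* e) :+ con 1/16 :* (e :* e)) refl ε))))
      (+-monoˡ-≤ (7/4 * ε) (norm₁-proj-mono (T ∖ (T ∖ H)) H (∖∖-⊆ T H) F))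
      where
      0<7/4ε : 0ℚ < 7/4 * ε
      0<7/4ε = ≤-<-trans (≤-reflexive (sym (*-zeroʳ 7/4))) (*-monoʳ-<-pos 7/4 0<ε)
      loss : weight F T - weight F (T ∖ (T ∖ H)) ≤ 3ℚ * (ε * ε)
      loss = *-cancel-pos (r ^ k) 0<ρ^k (≤-trans
        (weight-loss r (0≤ρ noise) (ρ≤1 noise) F k T H T≤k (9/8 * τ) (0≤* (nonNegative⁻¹ 9/8) (<⇒≤ 0<τ))
            unselected-light) τ≤)

    upper : norm₁ (proj H F) ≤ norm₁ (proj B F) + 1/8 * ε
    upper = ≤-trans (norm₁-proj-mono H (saturate π B) H⊆saturate F)
      (norm₁-proj-close B (saturate π B) (⊆-saturate π B) F (1/8 * ε)
        (≤-<-trans (≤-reflexive (sym (*-zeroʳ 1/8))) (*-monoʳ-<-pos 1/8 0<ε)) Y≤)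

    -- The budget is spent exactly on both sides: 7/4 + 1/16 - 13/16 = 1 below, and 1/8 + 1/16 +
    -- 13/16 = 1 above.
    good : GoodEstimate n k ε f (estimatedNorm H F ω′ + 13/16 * ε)
    good = (λ { g (T , T≤k , J) → ≤-by
               ((norm₁ (proj T F) - corr n g f) + ((norm₁ (proj H F) + 7/4 * ε - norm₁ (proj T F)) +
                   ((q - norm₁ (proj H F)) - - (1/16 * ε))))
               (0≤+ (0≤-diff (corr≤norm₁ T g f J)) (0≤+ (0≤-diff (lower T (ℕ→ℚ-cancel T≤k))) (0≤-diff (proj₂ bounds))))
               (solve 5 (λ q e c a b → q :+ con 13/16 :* e := (c :- e) :+
                   ((a :- c) :+ ((b :+ con 7/4 :* e :- a) :+ ((q :- b) :- (:- (con 1/16 :* e))))))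
                  refl q ε (corr n g f) (norm₁ (proj T F)) (norm₁ (proj H F))) })
         , sign-proj B f , (B , card-heavy≤k²/ε² , sign-proj-junta B f)
         , ≤-by ((norm₁ (proj B F) + 1/8 * ε - norm₁ (proj H F)) + (1/16 * ε - (q - norm₁ (proj H F))))
             (0≤+ (0≤-diff upper) (0≤-diff (proj₁ bounds)))
             (trans (cong (_+ ε) (corr-sign-proj B f)) (solve 4
                 (λ q e b c → c :+ e := (q :+ con 13/16 :* e) :+
                     ((c :+ con 1/8 :* e :- b) :+ (con 1/16 :* e :- (q :- b))))
                refl q ε (norm₁ (proj H F)) (norm₁ (proj B F))))
      where
      q = estimatedNorm H F ω′
      bounds = abs-bounds (q - norm₁ (proj H F)) {1/16 * ε} (0≤* (nonNegative⁻¹ 1/16) (<⇒≤ 0<ε)) normErr≤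

  -- The weights a to d are scaled so that violating any one requirement already costs 1, while each
  -- term has mean at most 1/12. In `c≥` the factor ½ ^ hashBits appears because `S` averages over
  -- buckets but every bucket must be accurate.
  module Scored (a b c d P : ℚ) (0≤a : 0ℚ ≤ a) (0≤b : 0ℚ ≤ b) (0≤c : 0ℚ ≤ c) (0≤d : 0ℚ ≤ d)
    (a≥ : 1ℚ ≤ a * (1/16 * (τ * τ))) (b≥ : 1ℚ ≤ b * ((1/8 * ε) * (1/8 * ε)))
    (c≥ : 1ℚ ≤ c * (½ ^ hashBits * ((1/32 * τ) * (1/32 * τ)))) (d≥ : 1ℚ ≤ d * ((1/16 * ε) * (1/16 * ε)))
    (k²/ε²≤P : k²/ε² k ε ≤ P)
    (a≤ : a * (½ ^ hashBits * (D * D)) ≤ 1/12) (b≤ : b * (½ ^ hashBits * P) ≤ 1/12)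
    (c≤ : c * (½ ^ influenceBits * 4ℚ) ≤ 1/12) (d≤ : d * (2ℚ * (½ ^ outerBits + ½ ^ innerBits)) ≤ 1/12) where

    X Y : Hash hashBits n → ℚ
    X = collisions w
    Y π = weight F (saturate π B) - weight F B

    S : Hash hashBits n → Tree (Sample n) influenceBits → ℚ
    S π ω = 𝔼 (cube hashBits) (influenceError² π ω)

    Z : Seed → ℚ
    Z (π , ω , ω′) = (a * X π + b * Y π) + (c * S π ω + d * normError² (selected θ F π ω) ω′)

    0≤X : ∀ π → 0ℚ ≤ X π
    0≤X = 0≤collisions w 0≤w

    0≤Y : ∀ π → 0ℚ ≤ Y π
    0≤Y π = 0≤-diff (weight-mono F B (saturate π B) (⊆-saturate π B))

    0≤influenceError² : ∀ π ω v → 0ℚ ≤ influenceError² π ω v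
    0≤influenceError² π ω v = 0≤sq (estimatedInfluence F π ω v - influence r F (bucket π v))

    0≤S : ∀ π ω → 0ℚ ≤ S π ω
    0≤S π ω = ∫-nonNeg ⟦ cube hashBits ⟧ (0≤influenceError² π ω)

    0≤normError² : ∀ H ω′ → 0ℚ ≤ normError² H ω′
    0≤normError² H ω′ = 0≤sq (estimatedNorm H F ω′ - norm₁ (proj H F))

    0≤Z : ∀ ω → 0ℚ ≤ Z ω
    0≤Z (π , ω , ω′) = 0≤+ (0≤+ (0≤* 0≤a (0≤X π)) (0≤* 0≤b (0≤Y π)))
        (0≤+ (0≤* 0≤c (0≤S π ω)) (0≤* 0≤d (0≤normError² _ ω′)))

    good-score : ∀ ω → Z ω < 1ℚ → GoodEstimate n k ε f (run f (estimateQ θ (13/16 * ε) ω))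
    good-score (π , ω , ω′) Z<1 = subst (GoodEstimate n k ε f) (sym (run-estimateQ f θ (13/16 * ε) π ω ω′))
      (Good.good π ω ω′
        (below 0≤a a≥ (≤-<-trans (first (0≤* 0≤b (0≤Y π)) (0≤+ 0≤cS 0≤dQ)) Z<1))
        (<⇒≤ (below 0≤b b≥ (≤-<-trans (≤-trans (≤-reflexive (sym (+-identityˡ _)))
            (≤-trans (+-monoˡ-≤ (b * Y π) (0≤* 0≤a (0≤X π))) (inl (0≤+ 0≤cS 0≤dQ)))) Z<1)))
        (λ v → *-cancel-pos (½ ^ hashBits) (½^-pos hashBits) (≤-trans
            (point≤ hashBits v (influenceError² π ω) (0≤influenceError² π ω))
           (<⇒≤ (below 0≤c c≥ (≤-<-trans (≤-trans (inl 0≤dQ) (inr (0≤+ (0≤* 0≤a (0≤X π)) (0≤* 0≤b (0≤Y π))))) Z<1)))))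
        (<⇒≤ (below 0≤d d≥ (≤-<-trans (≤-trans (inr 0≤cS) (inr (0≤+ (0≤* 0≤a (0≤X π)) (0≤* 0≤b (0≤Y π))))) Z<1))))
      where
      0≤cS : 0ℚ ≤ c * S π ω
      0≤cS = 0≤* 0≤c (0≤S π ω)
      0≤dQ : 0ℚ ≤ d * normError² (selected θ F π ω) ω′
      0≤dQ = 0≤* 0≤d (0≤normError² (selected θ F π ω) ω′)
      inl : ∀ {x y} → 0ℚ ≤ y → x ≤ x + y
      inl {x} {y} h = ≤-by y h refl
      inr : ∀ {x y} → 0ℚ ≤ x → y ≤ x + y
      inr {x} {y} h = ≤-by x h (+-comm x y)
      first : ∀ {x y z} → 0ℚ ≤ y → 0ℚ ≤ z → x ≤ (x + y) + z
      first h h′ = ≤-trans (inl h) (inl h′)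
      below : ∀ {u x y} → 0ℚ ≤ u → 1ℚ ≤ u * y → u * x < 1ℚ → x < y
      below {u} 0≤u uy≥ ux< = *-cancelˡ-<-nonNeg u {{nonNegative 0≤u}} (<-≤-trans ux< uy≥)

    𝔼-+ˡ : ∀ {A} (co : Coin A) u h → 𝔼 co (λ x → u + h x) ≡ u + 𝔼 co h
    𝔼-+ˡ co u h = trans (∫-+ ⟦ co ⟧ (λ _ → u) h) (cong (_+ 𝔼 co h) (𝔼-const co u))

    𝔼-normError²≤ : ∀ H → d * 𝔼 (tree (normSample n innerBits) outerBits) (normError² H) ≤ 1/12
    𝔼-normError²≤ H = ≤-trans (*-mono-nonNeg d 0≤d (estimateNorm-error outerBits innerBits H F F²≡1)) d≤

    𝔼S≤ : ∀ π → c * 𝔼 (tree (sample noise n) influenceBits) (S π) ≤ 1/12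
    𝔼S≤ π = ≤-trans (*-mono-nonNeg c 0≤c (≤-trans
        (≤-reflexive (∫-swap ⟦ tree (sample noise n) influenceBits ⟧ ⟦ cube hashBits ⟧ (λ ω v → influenceError² π ω v)))
        (≤-trans (∫-mono ⟦ cube hashBits ⟧ (λ v → variance-mean≤ (sample noise n) (sampleInfluence F (bucket π v))
            (influence r F (bucket π v))
            (𝔼-sampleInfluence noise F (bucket π v)) 4ℚ (sq≤4 (bucket π v)) influenceBits))
          (≤-reflexive (𝔼-const (cube hashBits) _))))) c≤
      where
      sq≤4 : ∀ A s → sampleInfluence F A s * sampleInfluence F A s ≤ 4ℚ
      sq≤4 A (R , x , y) = ≤-by ((u + v) * (u + v)) (0≤sq (u + v))
        (trans (cong₂ (λ p q → 2ℚ * (p + q)) (sym (F²≡1 (merge R x y))) (sym (F²≡1 (merge (R ∖ A) x y))))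
        (trans (solve 2 (λ u v → con 2ℚ :* (u :* u :+ v :* v) := con 1ℚ :* ((u :- v) :* (u :- v)) :+ (u :+ v) :*
            (u :+ v)) refl u v)
        (cong (_+ (u + v) * (u + v)) (trans (cong (_* ((u - v) * (u - v))) (sym (F²≡1 x)))
          (solve 2 (λ x z → x :* x :* (z :* z) := x :* z :* (x :* z)) refl (F x) (u - v))))))
        where
        u = F (merge R x y)
        v = F (merge (R ∖ A) x y)

    𝔼X≤ : a * 𝔼 (hash hashBits n) X ≤ 1/12
    𝔼X≤ = ≤-trans (*-mono-nonNeg a 0≤a (≤-trans (𝔼-collisions≤ hashBits w 0≤w)
       (*-mono-nonNeg (½ ^ hashBits) (^-nonNeg 0≤½ hashBits) (*-mono₂ (∫-nonNeg (fins n) 0≤w)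
           (≤-trans (∫-nonNeg (fins n) 0≤w) ∑w≤D) ∑w≤D ∑w≤D)))) a≤

    𝔼Y≤ : b * 𝔼 (hash hashBits n) Y ≤ 1/12
    𝔼Y≤ = ≤-trans (*-mono-nonNeg b 0≤b (≤-trans (𝔼-weight-saturate hashBits F F²≡1 B)
       (*-mono-nonNeg (½ ^ hashBits) (^-nonNeg 0≤½ hashBits) (≤-trans card-heavy≤k²/ε² k²/ε²≤P)))) b≤

    𝔼Z≤ : 𝔼 seed Z ≤ (1/12 + 1/12) + (1/12 + 1/12)
    -- The integration runs from the inside out: the norm samples are averaged with the selected set
    -- fixed, then the influence samples with the hash fixed.
    𝔼Z≤ = ≤-trans (∫-mono ⟦ hash hashBits n ⟧ (λ π → ≤-trans (∫-mono ⟦ T₁ ⟧ (λ ω → stepQ π ω)) (stepS π)))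
      (≤-trans (≤-reflexive (trans (∫-+ ⟦ hash hashBits n ⟧ _ _) (cong₂ _+_
          (trans (∫-+ ⟦ hash hashBits n ⟧ _ _) (cong₂ _+_ (∫-* ⟦ hash hashBits n ⟧ a X) (∫-* ⟦ hash hashBits n ⟧ b Y)))
          (𝔼-const (hash hashBits n) (1/12 + 1/12)))))
        (+-monoˡ-≤ (1/12 + 1/12) (+-mono-≤ 𝔼X≤ 𝔼Y≤)))
      where
      T₁ = tree (sample noise n) influenceBits
      T₂ = tree (normSample n innerBits) outerBits
      stepQ : ∀ π ω → 𝔼 T₂ (λ ω′ → Z (π , ω , ω′)) ≤ (a * X π + b * Y π) + (c * S π ω + 1/12)
      stepQ π ω = ≤-trans (≤-reflexive (trans (𝔼-+ˡ T₂ (a * X π + b * Y π) _)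
          (cong (a * X π + b * Y π +_) (trans (𝔼-+ˡ T₂ (c * S π ω) _) (cong (c * S π ω +_) (∫-* ⟦ T₂ ⟧ d _))))))
        (+-monoʳ-≤ (a * X π + b * Y π) (+-monoʳ-≤ (c * S π ω) (𝔼-normError²≤ (selected θ F π ω))))
      stepS : ∀ π → 𝔼 T₁ (λ ω → (a * X π + b * Y π) + (c * S π ω + 1/12)) ≤ (a * X π + b * Y π) + (1/12 + 1/12)
      stepS π = ≤-trans (≤-reflexive (trans (𝔼-+ˡ T₁ (a * X π + b * Y π) _) (cong (a * X π + b * Y π +_)
          (trans (∫-+ ⟦ T₁ ⟧ _ _) (cong₂ _+_ (∫-* ⟦ T₁ ⟧ c (S π)) (𝔼-const T₁ 1/12))))))
        (+-monoʳ-≤ (a * X π + b * Y π) (+-monoˡ-≤ 1/12 (𝔼S≤ π)))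

    success : PrAtLeast f (GoodEstimate n k ε f) (flips seed (λ ω → toAlg (estimateQ θ (13/16 * ε) ω))) twoThirds
    success = PrAtLeast-weaken f _ (+-monoʳ-≤ 1ℚ (neg-antimono-≤ 𝔼Z≤))
      (PrAtLeast-markov f _ seed (estimateQ θ (13/16 * ε)) Z 0≤Z good-score)

-- Choice of parameters

floor*↧≤↥ : ∀ p → floor p ℤ.* ↧ p ℤ.≤ ↥ p
floor*↧≤↥ p@record{} = ℤₚ.[n/d]*d≤n (↥ p) (↧ p)

≤-ceiling : ∀ p → p ≤ ℕ→ℚ ℤ.∣ ceiling p ∣
≤-ceiling p@record{} = toℚᵘ-cancel-≤ (ℚᵘₚ.≤-trans (ℚᵘ.*≤* bound)
  (ℚᵘₚ.≤-reflexive (ℚᵘₚ.≃-sym (toℚᵘ-fromℚᵘ (ℚᵘ.mkℚᵘ (ℤ.+ ℤ.∣ ceiling p ∣) 0)))))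
  where
  fl = floor (- p)
  below : fl ℤ.* ↧ p ℤ.≤ ℤ.- (↥ p)
  below = subst₂ ℤ._≤_ (cong (fl ℤ.*_) (↧-neg p)) (↥-neg p) (floor*↧≤↥ (- p))
  bound : ↥ p ℤ.* ℤ.+ 1 ℤ.≤ ℤ.+ ℤ.∣ ceiling p ∣ ℤ.* ↧ p
  bound = ℤₚ.≤-trans (ℤₚ.≤-reflexive (trans (ℤₚ.*-identityʳ (↥ p)) (sym (ℤₚ.neg-involutive (↥ p)))))
    (ℤₚ.≤-trans (ℤₚ.neg-mono-≤ below) (ℤₚ.≤-trans (ℤₚ.≤-reflexive (ℤₚ.neg-distribˡ-* fl (↧ p)))
      (ℤₚ.*-monoʳ-≤-nonNeg (↧ p) (i≤∣i∣ (ceiling p)))))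
    where
    i≤∣i∣ : ∀ i → i ℤ.≤ ℤ.+ ℤ.∣ i ∣
    i≤∣i∣ (ℤ.+ _)      = ℤₚ.≤-refl
    i≤∣i∣ ℤ.-[1+ _ ] = ℤ.-≤+

lg : ℕ → ℕ
lg zero    = 0
lg (suc u) with suc u ℕ.≤? 2 ℕ.^ lg u
... | yes _ = lg u
... | no  _ = suc (lg u)

≤2^lg : ∀ u → u ℕ.≤ 2 ℕ.^ lg u
≤2^lg zero    = ℕ.z≤n
≤2^lg (suc u) with suc u ℕ.≤? 2 ℕ.^ lg u
... | yes h = h
... | no  _ = ℕₚ.+-mono-≤ (ℕₚ.m^n>0 2 (lg u)) (ℕₚ.≤-trans (≤2^lg u) (ℕₚ.m≤m+n (2 ℕ.^ lg u) 0))

2^lg≤ : ∀ u → 2 ℕ.^ lg u ℕ.≤ suc (2 ℕ.* u)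
2^lg≤-suc : ∀ u → 2 ℕ.^ lg (suc u) ℕ.≤ 2 ℕ.* suc u
2^lg≤ zero    = ℕₚ.≤-refl
2^lg≤ (suc u) = ℕₚ.m≤n⇒m≤1+n (2^lg≤-suc u)
2^lg≤-suc u with suc u ℕ.≤? 2 ℕ.^ lg u
... | yes _ = ℕₚ.≤-trans (2^lg≤ u) (ℕₚ.≤-trans (ℕₚ.n≤1+n _) (ℕₚ.≤-reflexive (sym (ℕₚ.*-suc 2 u))))
... | no  h = ℕₚ.*-monoʳ-≤ 2 (ℕₚ.≤-trans (ℕₚ.n≤1+n _) (ℕₚ.≰⇒> h))

^-+ : ∀ a m n → a ^ (m ℕ.+ n) ≡ a ^ m * a ^ n
^-+ a zero    n = sym (*-identityˡ (a ^ n))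
^-+ a (suc m) n = trans (cong (a *_) (^-+ a m n)) (sym (*-assoc a (a ^ m) (a ^ n)))

2^-pos : ∀ n → 0ℚ < 2ℚ ^ n
2^-pos zero    = positive⁻¹ 1ℚ
2^-pos (suc n) = ≤-<-trans (≤-reflexive (sym (*-zeroʳ 2ℚ))) (*-monoʳ-<-pos 2ℚ (2^-pos n))

0≤2^ : ∀ n → 0ℚ ≤ 2ℚ ^ n
0≤2^ n = <⇒≤ (2^-pos n)

2^*½^ : ∀ n → 2ℚ ^ n * ½ ^ n ≡ 1ℚ
2^*½^ zero    = refl
2^*½^ (suc n) = trans (solve 2 (λ a b → con 2ℚ :* a :* (con ½ :* b) := a :* b) refl (2ℚ ^ n) (½ ^ n)) (2^*½^ n)

2^*½^-+ : ∀ m n → 2ℚ ^ m * ½ ^ (m ℕ.+ n) ≡ ½ ^ n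
2^*½^-+ m n = trans (cong (2ℚ ^ m *_) (^-+ ½ m n)) (trans (sym (*-assoc (2ℚ ^ m) (½ ^ m) (½ ^ n)))
  (trans (cong (_* ½ ^ n) (2^*½^ m)) (*-identityˡ (½ ^ n))))

ℕ→ℚ-2^ : ∀ n → ℕ→ℚ (2 ℕ.^ n) ≡ 2ℚ ^ n
ℕ→ℚ-2^ zero    = refl
ℕ→ℚ-2^ (suc n) = trans (ℕ→ℚ-* 2 (2 ℕ.^ n)) (cong (2ℚ *_) (ℕ→ℚ-2^ n))

bernoulli : ∀ κ → 0ℚ ≤ κ → κ ≤ 1ℚ → ∀ k → 1ℚ - ℕ→ℚ k * κ ≤ (1ℚ - κ) ^ k
bernoulli κ 0≤κ κ≤1 zero    = ≤-reflexive (solve 1 (λ κ → con 1ℚ :- con 0ℚ :* κ := con 1ℚ) refl κ)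
bernoulli κ 0≤κ κ≤1 (suc k) = ≤-trans
  (≤-by (ℕ→ℚ k * (κ * κ)) (0≤* (0≤ℕ→ℚ k) (0≤sq κ))
    (trans (solve 2 (λ κ k → (con 1ℚ :- κ) :* (con 1ℚ :- k :* κ) := con 1ℚ :- (con 1ℚ :+ k) :* κ :+ k :* (κ :* κ)) refl
        κ (ℕ→ℚ k))
      (cong (λ z → 1ℚ - z * κ + ℕ→ℚ k * (κ * κ)) (sym (ℕ→ℚ-+ 1 k)))))
  (*-mono-nonNeg (1ℚ - κ) (0≤-diff κ≤1) (bernoulli κ 0≤κ κ≤1 k))

-- a second-order lower bound on (1 - κ)^{-m}
inverse-power-bound : ∀ κ → 0ℚ ≤ κ → κ ≤ 1ℚ → ∀ m →
  (1ℚ - κ) ^ m * (2ℚ + 2ℚ * (ℕ→ℚ m * κ) + ℕ→ℚ m * (ℕ→ℚ m + 1ℚ) * (κ * κ)) ≤ 2ℚ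
inverse-power-bound κ 0≤κ κ≤1 zero    = ≤-reflexive (solve 1 (λ κ → con 1ℚ :*
    (con 2ℚ :+ con 2ℚ :* (con 0ℚ :* κ) :+ con 0ℚ :* (con 0ℚ :+ con 1ℚ) :* (κ :* κ)) := con 2ℚ) refl κ)
inverse-power-bound κ 0≤κ κ≤1 (suc m) = ≤-trans (≤-reflexive (cong
    (λ z → (1ℚ - κ) * p * (2ℚ + 2ℚ * (z * κ) + z * (z + 1ℚ) * (κ * κ))) (ℕ→ℚ-+ 1 m)))
  (≤-trans (≤-by (p * ((x + 1ℚ) * (x + 2ℚ) * (κ * (κ * κ))))
     (0≤* (^-nonNeg (0≤-diff κ≤1) m) (0≤* (0≤* (0≤+ 0≤x (nonNegative⁻¹ 1ℚ)) (0≤+ 0≤x (nonNegative⁻¹ 2ℚ)))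
         (0≤* 0≤κ (0≤sq κ))))
     (solve 3 (λ κ p x → p :* (con 2ℚ :+ con 2ℚ :* (x :* κ) :+ x :* (x :+ con 1ℚ) :* (κ :* κ)) :=
        (con 1ℚ :- κ) :* p :* (con 2ℚ :+ con 2ℚ :* ((con 1ℚ :+ x) :* κ) :+ (con 1ℚ :+ x) :* (con 1ℚ :+ x :+ con 1ℚ) :*
            (κ :* κ))
        :+ p :* ((x :+ con 1ℚ) :* (x :+ con 2ℚ) :* (κ :* (κ :* κ)))) refl κ p x))
    (inverse-power-bound κ 0≤κ κ≤1 m))
  where
  p = (1ℚ - κ) ^ m
  x = ℕ→ℚ m
  0≤x = 0≤ℕ→ℚ m

-- With x = mκ, the second-order bound gives 2 ≥ p(2 + 2x + x²), and 2 + 2x + x² = 4x + 1 + (1 -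
-- x)². A first-order bound would yield the constant 1 instead of 2, doubling D and with it τ, and
-- the loss would no longer fit into 3ε².
m*power≤ : ∀ κ → 0ℚ ≤ κ → κ ≤ 1ℚ → ∀ m → 2ℚ * κ * (ℕ→ℚ m * (1ℚ - κ) ^ m) ≤ 1ℚ
m*power≤ κ 0≤κ κ≤1 m = *-cancel-pos 2ℚ (positive⁻¹ 2ℚ) (≤-trans
  (≤-by (p * (1ℚ + (1ℚ - x * κ) * (1ℚ - x * κ) + x * (κ * κ)))
    (0≤* (^-nonNeg (0≤-diff κ≤1) m) (0≤+ (0≤+ (nonNegative⁻¹ 1ℚ) (0≤sq (1ℚ - x * κ))) (0≤* (0≤ℕ→ℚ m) (0≤sq κ))))
    (solve 3 (λ κ p x → p :* (con 2ℚ :+ con 2ℚ :* (x :* κ) :+ x :* (x :+ con 1ℚ) :* (κ :* κ)) :=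
       con 2ℚ :* (con 2ℚ :* κ :* (x :* p)) :+ p :* (con 1ℚ :+ (con 1ℚ :- x :* κ) :* (con 1ℚ :- x :* κ) :+ x :*
           (κ :* κ))) refl κ p x))
  (inverse-power-bound κ 0≤κ κ≤1 m))
  where
  p = (1ℚ - κ) ^ m
  x = ℕ→ℚ m

-- The last two fields bound 1/τ and D by powers of the scale 2^v; they are what makes the sample
-- sizes polynomial.
record Threshold (k : ℕ) (ε : ℚ) .{{_ : Positive ε}} (v : ℕ) : Set where
  field
    noise : ℕ
    τ D   : ℚ
    0<τ   : 0ℚ < τ
    0<ρ^k : 0ℚ < ρ noise ^ k
    mρ^m≤D : ∀ m → ℕ→ℚ m * ρ noise ^ m ≤ D
    D≤    : D * (ε * ε) ≤ τ * (ℕ→ℚ k * ℕ→ℚ k)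
    τ≤    : ℕ→ℚ k * (9/8 * τ) ≤ ρ noise ^ k * (3ℚ * (ε * ε))
    τ≥    : 1ℚ ≤ 2ℚ ^ (v ℕ.+ v) * τ
    D≤2V  : D ≤ 2ℚ ^ (suc v)

1≤2^ : ∀ n → 1ℚ ≤ 2ℚ ^ n
1≤2^ n = ≤-trans (ℕ→ℚ-mono (ℕₚ.m^n>0 2 n)) (≤-reflexive (ℕ→ℚ-2^ n))

sq-mono : ∀ {a b} → 0ℚ ≤ a → a ≤ b → a * a ≤ b * b
sq-mono 0≤a a≤b = *-mono₂ 0≤a (≤-trans 0≤a a≤b) a≤b a≤b

1≤⇒1≤sq : ∀ {a} → 1ℚ ≤ a → 1ℚ ≤ a * a
1≤⇒1≤sq = sq-mono (nonNegative⁻¹ 1ℚ)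

ceiling-1/ : (ε : ℚ) .{{_ : Positive ε}} → ℕ
ceiling-1/ ε {{p}} = ℤ.∣ ceiling ((1/ ε) {{pos⇒nonZero ε {{p}}}}) ∣

-- The successor keeps the scale 2^v above 1/ε even for k = 0.
scaleBits : (k : ℕ) (ε : ℚ) .{{_ : Positive ε}} → ℕ
scaleBits k ε = lg (suc k ℕ.* ceiling-1/ ε)

module _ (k : ℕ) (ε : ℚ) .{{pos : Positive ε}} where
  private
    i = (1/ ε) {{pos⇒nonZero ε}}
    v = scaleBits k ε
    ε*i≡1 : ε * i ≡ 1ℚ
    ε*i≡1 = *-inverseʳ ε {{pos⇒nonZero ε}}
    0<i : 0ℚ < i
    0<i = positive⁻¹ i {{1/pos⇒pos ε}}

  suc-k≤2^v*ε : ℕ→ℚ (suc k) ≤ 2ℚ ^ v * ε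
  suc-k≤2^v*ε = *-cancel-pos i 0<i (≤-trans (≤-trans (≤-reflexive (*-comm i (ℕ→ℚ (suc k)))) (≤-trans
      (*-mono-nonNeg (ℕ→ℚ (suc k)) (0≤ℕ→ℚ (suc k)) (≤-ceiling i))
      (≤-trans (≤-reflexive (sym (ℕ→ℚ-* (suc k) (ceiling-1/ ε))))
      (≤-trans (ℕ→ℚ-mono (≤2^lg (suc k ℕ.* ceiling-1/ ε))) (≤-reflexive (ℕ→ℚ-2^ v))))))
    (≤-reflexive (sym (trans (solve 3 (λ i V e → i :* (V :* e) := V :* (e :* i)) refl i (2ℚ ^ v) ε)
      (trans (cong (2ℚ ^ v *_) ε*i≡1) (*-identityʳ (2ℚ ^ v)))))))

  1≤2^v*ε : 1ℚ ≤ 2ℚ ^ v * ε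
  1≤2^v*ε = ≤-trans (ℕ→ℚ-mono {1} {suc k} (ℕ.s≤s ℕ.z≤n)) suc-k≤2^v*ε

  k²/ε²≤ : k²/ε² k ε ≤ 2ℚ ^ (v ℕ.+ v)
  k²/ε²≤ = ≤-trans (sq-mono (0≤* (0≤ℕ→ℚ k) (<⇒≤ 0<i))
      (≤-trans (*-monoʳ-≤-nonNeg i {{nonNegative (<⇒≤ 0<i)}} (≤-trans (ℕ→ℚ-mono (ℕₚ.n≤1+n k)) suc-k≤2^v*ε))
        (≤-reflexive (trans (*-assoc (2ℚ ^ v) ε i) (trans (cong (2ℚ ^ v *_) ε*i≡1) (*-identityʳ (2ℚ ^ v)))))))
    (≤-reflexive (sym (^-+ 2ℚ v v)))

  ceiling-pos : 1 ℕ.≤ ceiling-1/ ε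
  ceiling-pos with ceiling-1/ ε | ≤-ceiling i
  ... | zero  | i≤0 = ⊥-elim (<-irrefl refl (<-≤-trans 0<i i≤0))
  ... | suc _ | _   = ℕ.s≤s ℕ.z≤n

threshold : ∀ k ε .{{_ : Positive ε}} → Threshold k ε (scaleBits k ε)
-- For k = 0 there must be no heavy coordinate. Noise 0 gives ρ = 0, so m ρ^m vanishes for every m
-- (at m = 0 through the factor m), and D = 0 is allowed; τ may then be any convenient positive
-- number.
threshold zero ε = record
  { noise = 0 ; τ = 1ℚ ; D = 0ℚ ; 0<τ = positive⁻¹ 1ℚ ; 0<ρ^k = positive⁻¹ 1ℚ
  ; mρ^m≤D = λ { zero → ≤-refl ; (suc m) → ≤-reflexive (trans (cong (ℕ→ℚ (suc m) *_) (*-zeroˡ (ρ 0 ^ m)))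
      (*-zeroʳ (ℕ→ℚ (suc m)))) }
  ; D≤ = ≤-reflexive (*-zeroˡ (ε * ε))
  ; τ≤ = 0≤* (nonNegative⁻¹ 1ℚ) (0≤* (nonNegative⁻¹ 3ℚ) (0≤sq ε))
  ; τ≥ = ≤-trans (1≤2^ (v ℕ.+ v)) (≤-reflexive (sym (*-identityʳ (2ℚ ^ (v ℕ.+ v)))))
  ; D≤2V = 0≤2^ (suc v)
  }
  where v = scaleBits zero ε
-- With K = 2^noise in [2k, 4k], m ρ^m ≤ K/2 = D and ρ^k ≥ 1 - k/K; τ = Kε²/2k² then makes D/τ exactly k²/ε².
threshold k@(suc k′) ε = record
  { noise = suc (lg k) ; τ = τ ; D = L ; 0<τ = 0<τ ; 0<ρ^k = 0<ρ^k
  ; mρ^m≤D = λ m → ≤-trans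
      (≤-reflexive (sym (trans (sym (*-assoc L l _)) (trans (cong (_* (ℕ→ℚ m * ρ (suc (lg k)) ^ m)) L*l≡1)
          (*-identityˡ _)))))
      (≤-trans (*-mono-nonNeg L (0≤2^ (lg k)) (≤-trans
         (≤-reflexive (cong (_* (ℕ→ℚ m * ρ (suc (lg k)) ^ m)) (solve 1 (λ l → l := con 2ℚ :* (con ½ :* l)) refl l)))
         (m*power≤ (½ * l) (^-nonNeg 0≤½ (suc (lg k))) (½^-≤1 (suc (lg k))) m))) (≤-reflexive (*-identityʳ L)))
  ; D≤ = ≤-reflexive (sym (trans (solve 4 (λ L e j K → L :* (e :* e) :* (j :* j) :* (K :* K) := L :* (e :* e) :*
      ((K :* j) :* (K :* j))) refl L ε j K)
           (trans (cong (λ z → L * (ε * ε) * (z * z)) K*j≡1) (*-identityʳ (L * (ε * ε))))))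
  ; τ≤ = ≤-trans (≤-reflexive (trans (solve 4 (λ L e j K → K :* (con 9/8 :* (L :* (e :* e) :* (j :* j))) := con 9/8 :*
      (L :* j) :* (K :* j) :* (e :* e)) refl L ε j K)
             (cong (λ z → z * (ε * ε)) (trans (cong (9/8 * z *_) K*j≡1) (*-identityʳ (9/8 * z))))))
           (≤-trans (*-monoʳ-≤-nonNeg (ε * ε) {{nonNegative (0≤sq ε)}} (≤-trans core (*-monoʳ-≤-nonNeg 3ℚ power≥)))
             (≤-reflexive (*-assoc (ρ (suc (lg k)) ^ k) 3ℚ (ε * ε))))
  ; τ≥ = τ≥
  ; D≤2V = ≤-trans (≤-reflexive (sym (ℕ→ℚ-2^ (lg k)))) (≤-trans (ℕ→ℚ-mono
        (ℕₚ.≤-trans (2^lg≤-suc k′) (ℕₚ.*-monoʳ-≤ 2 (ℕₚ.≤-trans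
            (ℕₚ.m≤m*n k (ceiling-1/ ε) {{ℕ.>-nonZero (ceiling-pos k ε)}})
          (ℕₚ.≤-trans (ℕₚ.*-monoˡ-≤ (ceiling-1/ ε) (ℕₚ.n≤1+n k)) (≤2^lg (suc k ℕ.* ceiling-1/ ε)))))))
      (≤-reflexive (ℕ→ℚ-2^ (suc v))))
  }
  where
  v = scaleBits k ε
  V = 2ℚ ^ v
  K = ℕ→ℚ k
  instance
    K-pos : Positive K
    K-pos = normalize-pos k 1
  j = (1/ K) {{pos⇒nonZero K}}
  K*j≡1 : K * j ≡ 1ℚ
  K*j≡1 = *-inverseʳ K {{pos⇒nonZero K}}
  0<j : 0ℚ < j
  0<j = positive⁻¹ j {{1/pos⇒pos K}}
  L = 2ℚ ^ lg k
  l = ½ ^ lg k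
  τ = L * (ε * ε) * (j * j)
  L*l≡1 : L * l ≡ 1ℚ
  L*l≡1 = 2^*½^ (lg k)
  0≤l : 0ℚ ≤ l
  0≤l = ^-nonNeg 0≤½ (lg k)
  z = L * j
  s = K * l
  0≤z : 0ℚ ≤ z
  0≤z = 0≤* (0≤2^ (lg k)) (<⇒≤ 0<j)
  s*z≡1 : s * z ≡ 1ℚ
  s*z≡1 = trans (solve 4 (λ K l L j → K :* l :* (L :* j) := (K :* j) :* (L :* l)) refl K l L j) (cong₂ _*_ K*j≡1 L*l≡1)
  K≤L : K ≤ L
  K≤L = ≤-trans (ℕ→ℚ-mono (≤2^lg k)) (≤-reflexive (ℕ→ℚ-2^ (lg k)))
  L≤2K : L ≤ 2ℚ * K
  L≤2K = ≤-trans (≤-reflexive (sym (ℕ→ℚ-2^ (lg k)))) (≤-trans (ℕ→ℚ-mono (2^lg≤-suc k′)) (≤-reflexive (ℕ→ℚ-* 2 k)))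
  s≤1 : s ≤ 1ℚ
  s≤1 = ≤-trans (*-monoʳ-≤-nonNeg l {{nonNegative 0≤l}} K≤L) (≤-reflexive L*l≡1)
  ½≤s : ½ ≤ s
  ½≤s = ≤-trans (≤-reflexive (sym (trans (cong (½ *_) L*l≡1) (*-identityʳ ½))))
    (≤-trans (*-mono-nonNeg ½ 0≤½ (*-monoʳ-≤-nonNeg l {{nonNegative 0≤l}} L≤2K))
      (≤-reflexive (solve 2 (λ K l → con ½ :* (con 2ℚ :* K :* l) := K :* l) refl K l)))
  power≥ : 1ℚ - K * (½ * l) ≤ ρ (suc (lg k)) ^ k
  power≥ = bernoulli (½ * l) (^-nonNeg 0≤½ (suc (lg k))) (½^-≤1 (suc (lg k))) k
  0<ρ^k : 0ℚ < ρ (suc (lg k)) ^ k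
  0<ρ^k = <-≤-trans (positive⁻¹ ½) (≤-trans (≤-by (½ * (1ℚ - s)) (0≤* 0≤½ (0≤-diff s≤1))
    (solve 2 (λ K l → con 1ℚ :- K :* (con ½ :* l) := con ½ :+ con ½ :* (con 1ℚ :- K :* l)) refl K l)) power≥)
  -- Here s = k/L lies in [1/2, 1] and z = 1/s. Divided by z, the claim is 9/8 ≤ (3/2)s(2 - s), an
  -- equality at s = 1/2; this endpoint is where the constant 3 in the loss comes from.
  core : 9/8 * z ≤ (1ℚ - K * (½ * l)) * 3ℚ
  core = ≤-by ((3ℚ * ½) * z * ((s - ½) * (1ℚ + ½ - s)))
    (0≤* (0≤* (nonNegative⁻¹ (3ℚ * ½)) 0≤z) (0≤* (0≤-diff ½≤s) (0≤-diff (≤-trans s≤1 (≤-by ½ 0≤½ refl)))))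
    (trans (solve 2 (λ K l → (con 1ℚ :- K :* (con ½ :* l)) :* con 3ℚ := con 1ℚ :* (con 3ℚ :- con (3ℚ * ½) :* (K :* l)))
        refl K l)
    (trans (cong (_* (3ℚ - 3ℚ * ½ * s)) (sym s*z≡1))
      (trans (solve 2 (λ s z → s :* z :* (con 3ℚ :- con (3ℚ * ½) :* s) :=
         con 9/8 :* z :+ con (3ℚ * ½) :* z :* ((s :- con ½) :* (con (1ℚ + ½) :- s))) refl s z) refl)))
  0<τ : 0ℚ < τ
  0<τ = positive⁻¹ τ {{pos*pos⇒pos (L * (ε * ε)) {{pos*pos⇒pos L {{positive (2^-pos (lg k))}} (ε * ε)
      {{pos*pos⇒pos ε ε}}}} (j * j) {{pos*pos⇒pos j {{positive 0<j}} j {{positive 0<j}}}}}}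
  τ≥ : 1ℚ ≤ 2ℚ ^ (v ℕ.+ v) * τ
  -- V²τ = L(Vε)²/k². One k is cancelled by L ≥ k, the other by one factor Vε ≥ k + 1; the remaining
  -- factor Vε is at least 1.
  τ≥ = ≤-trans (≤-reflexive (sym (cong₂ _*_ K*j≡1 K*j≡1))) (≤-trans
      (≤-trans (≤-reflexive (solve 2 (λ K j → (K :* j) :* (K :* j) := K :* (K :* con 1ℚ) :* (j :* j)) refl K j))
        (*-monoʳ-≤-nonNeg (j * j) {{nonNegative (0≤sq j)}} (*-mono₂ (0≤ℕ→ℚ k) (0≤sq (V * ε)) K≤L (*-mono₂ (0≤ℕ→ℚ k) 0≤Vε
          (≤-trans (ℕ→ℚ-mono (ℕₚ.n≤1+n k)) (suc-k≤2^v*ε k ε)) (1≤2^v*ε k ε)))))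
      (≤-reflexive (trans (solve 4 (λ V e L j → L :* (V :* e :* (V :* e)) :* (j :* j) := V :* V :*
          (L :* (e :* e) :* (j :* j))) refl V ε L j)
        (cong (_* τ) (sym (^-+ 2ℚ v v))))))
    where
    0≤Vε : 0ℚ ≤ V * ε
    0≤Vε = ≤-trans (nonNegative⁻¹ 1ℚ) (1≤2^v*ε k ε)

-- Sample sizes and the query count

-- These solve `a≤`, `c≤` and `d≤` for the weights chosen below. The hash pays 4v for τ⁻² and 2v for
-- D². The influence samples pay 4v for τ⁻² on top of `hashBits`, as all buckets must be accurate;
-- the norm samples pay 2v for ε⁻². Each constant contains a final 4, from 1/16 ≤ 1/12.
sizes : ℕ → ℕ → Sizes
sizes noise v = record
  { noise = noise ; hashBits = 6 ℕ.* v ℕ.+ 10 ; influenceBits = 10 ℕ.* v ℕ.+ 26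
  ; outerBits = 2 ℕ.* v ℕ.+ 14 ; innerBits = 2 ℕ.* v ℕ.+ 14 }

algorithmPos : ∀ n k ε .{{_ : Positive ε}} → Alg n
algorithmPos n k ε = flips seed (λ ω → toAlg (estimateQ (35/32 * τ) (13/16 * ε) ω))
  where
  open Threshold (threshold k ε)
  open Procedure n (sizes noise (scaleBits k ε))

½^4≤1/12 : ½ ^ 4 ≤ 1/12
½^4≤1/12 = ≤-by (ℤ.+ 1 / 48) (nonNegative⁻¹ (ℤ.+ 1 / 48)) refl

cancel-powers : ∀ m {x} e → x ≡ 2ℚ ^ m * ½ ^ e → ∀ r → e ≡ m ℕ.+ (r ℕ.+ 4) → x ≤ 1/12
cancel-powers m e x≡ r refl = ≤-trans (≤-reflexive (trans x≡ (2^*½^-+ m (r ℕ.+ 4)))) (≤-trans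
  (^-antitone 0≤½ (½^-≤1 1) (ℕₚ.m≤n+m 4 r)) ½^4≤1/12)

algorithmPos-correct : ∀ n k ε .{{_ : Positive ε}} (f : BoolFn n) →
                       PrAtLeast f (GoodEstimate n k ε f) (algorithmPos n k ε) twoThirds
algorithmPos-correct n k ε f = Correctness.Scored.success n k ε f (sizes noise v) τ D 0<τ 0<ρ^k mρ^m≤D D≤ τ≤
    (2ℚ ^ ea) (2ℚ ^ eb) (2ℚ ^ ec) (2ℚ ^ ed) (2ℚ ^ (v ℕ.+ v))
    (0≤2^ ea) (0≤2^ eb) (0≤2^ ec) (0≤2^ ed) a≥ b≥ c≥ d≥ (k²/ε²≤ k ε) a≤ b≤ c≤ d≤
  where
  open Threshold (threshold k ε)
  v  = scaleBits k ε
  s  = 6 ℕ.* v ℕ.+ 10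
  t  = 10 ℕ.* v ℕ.+ 26
  t′ = 2 ℕ.* v ℕ.+ 14
  ea = 4 ℕ.+ ((v ℕ.+ v) ℕ.+ (v ℕ.+ v))
  eb = 6 ℕ.+ (v ℕ.+ v)
  ec = s ℕ.+ (10 ℕ.+ ((v ℕ.+ v) ℕ.+ (v ℕ.+ v)))
  ed = 8 ℕ.+ (v ℕ.+ v)
  V  = 2ℚ ^ v
  V² = 2ℚ ^ (v ℕ.+ v)
  1≤V²τ² : 1ℚ ≤ (V² * τ) * (V² * τ)
  1≤V²τ² = 1≤⇒1≤sq τ≥
  1≤V²ε² : 1ℚ ≤ (V * ε) * (V * ε)
  1≤V²ε² = 1≤⇒1≤sq (1≤2^v*ε k ε)
  V⁴ : 2ℚ ^ ((v ℕ.+ v) ℕ.+ (v ℕ.+ v)) ≡ V² * V²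
  V⁴ = ^-+ 2ℚ (v ℕ.+ v) (v ℕ.+ v)
  a≥ : 1ℚ ≤ 2ℚ ^ ea * (1/16 * (τ * τ))
  a≥ = ≤-trans 1≤V²τ² (≤-reflexive (trans (solve 2 (λ W t → (W :* t) :* (W :* t) := con (2ℚ ^ 4) :* (W :* W) :*
      (con 1/16 :* (t :* t))) refl V² τ)
    (cong (_* (1/16 * (τ * τ))) (sym (trans (^-+ 2ℚ 4 (v ℕ.+ v ℕ.+ (v ℕ.+ v))) (cong (2ℚ ^ 4 *_) V⁴))))))
  b≥ : 1ℚ ≤ 2ℚ ^ eb * ((1/8 * ε) * (1/8 * ε))
  b≥ = ≤-trans 1≤V²ε² (≤-reflexive (trans (solve 2 (λ V e → (V :* e) :* (V :* e) := con (2ℚ ^ 6) :* (V :* V) :*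
      (con 1/8 :* e :* (con 1/8 :* e))) refl V ε)
    (cong (_* ((1/8 * ε) * (1/8 * ε))) (sym (trans (^-+ 2ℚ 6 (v ℕ.+ v)) (cong (2ℚ ^ 6 *_) (^-+ 2ℚ v v)))))))
  c≥ : 1ℚ ≤ 2ℚ ^ ec * (½ ^ s * ((1/32 * τ) * (1/32 * τ)))
  c≥ = ≤-trans 1≤V²τ² (≤-reflexive (trans (solve 2 (λ W t → (W :* t) :* (W :* t) := con 1ℚ :*
      (con (2ℚ ^ 10) :* (W :* W) :* (con 1/32 :* t :* (con 1/32 :* t)))) refl V² τ)
    (trans (cong (_* (2ℚ ^ 10 * (V² * V²) * ((1/32 * τ) * (1/32 * τ)))) (sym (2^*½^ s)))
    (trans (solve 4 (λ S h c x → S :* h :* (c :* x) := S :* c :* (h :* x)) refl (2ℚ ^ s) (½ ^ s) (2ℚ ^ 10 * (V² * V²))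
        ((1/32 * τ) * (1/32 * τ)))
    (cong (_* (½ ^ s * ((1/32 * τ) * (1/32 * τ)))) (sym (trans (^-+ 2ℚ s (10 ℕ.+ (v ℕ.+ v ℕ.+ (v ℕ.+ v))))
        (cong (2ℚ ^ s *_) (trans (^-+ 2ℚ 10 (v ℕ.+ v ℕ.+ (v ℕ.+ v))) (cong (2ℚ ^ 10 *_) V⁴))))))))))
  d≥ : 1ℚ ≤ 2ℚ ^ ed * ((1/16 * ε) * (1/16 * ε))
  d≥ = ≤-trans 1≤V²ε² (≤-reflexive (trans (solve 2 (λ V e → (V :* e) :* (V :* e) := con (2ℚ ^ 8) :* (V :* V) :*
      (con 1/16 :* e :* (con 1/16 :* e))) refl V ε)
    (cong (_* ((1/16 * ε) * (1/16 * ε))) (sym (trans (^-+ 2ℚ 8 (v ℕ.+ v)) (cong (2ℚ ^ 8 *_) (^-+ 2ℚ v v)))))))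
  0≤D : 0ℚ ≤ D
  0≤D = mρ^m≤D 0
  a≤ : 2ℚ ^ ea * (½ ^ s * (D * D)) ≤ 1/12
  a≤ = ≤-trans (*-mono-nonNeg (2ℚ ^ ea) (0≤2^ ea) (*-mono-nonNeg (½ ^ s) (^-nonNeg 0≤½ s) (sq-mono 0≤D D≤2V)))
    (cancel-powers (ea ℕ.+ (suc v ℕ.+ suc v)) s
      (trans (solve 3 (λ A h x → A :* (h :* (x :* x)) := A :* (x :* x) :* h) refl (2ℚ ^ ea) (½ ^ s) (2ℚ ^ suc v))
        (cong (_* ½ ^ s) (sym (trans (^-+ 2ℚ ea _) (cong (2ℚ ^ ea *_) (^-+ 2ℚ (suc v) (suc v)))))))
      0 (exponent v))
    where
    exponent : ∀ v → 6 ℕ.* v ℕ.+ 10 ≡ 4 ℕ.+ ((v ℕ.+ v) ℕ.+ (v ℕ.+ v)) ℕ.+ (suc v ℕ.+ suc v) ℕ.+ (0 ℕ.+ 4)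
    exponent = solve-∀
  b≤ : 2ℚ ^ eb * (½ ^ s * V²) ≤ 1/12
  b≤ = cancel-powers (eb ℕ.+ (v ℕ.+ v)) s
      (trans (solve 3 (λ A h x → A :* (h :* x) := A :* x :* h) refl (2ℚ ^ eb) (½ ^ s) V²)
          (cong (_* ½ ^ s) (sym (^-+ 2ℚ eb (v ℕ.+ v)))))
      (v ℕ.+ v) (exponent v)
    where
    exponent : ∀ v → 6 ℕ.* v ℕ.+ 10 ≡ 6 ℕ.+ (v ℕ.+ v) ℕ.+ (v ℕ.+ v) ℕ.+ (v ℕ.+ v ℕ.+ 4)
    exponent = solve-∀
  c≤ : 2ℚ ^ ec * (½ ^ t * 4ℚ) ≤ 1/12
  c≤ = cancel-powers (2 ℕ.+ ec) t
      (solve 2 (λ A h → A :* (h :* con 4ℚ) := con 2ℚ :* (con 2ℚ :* A) :* h) refl (2ℚ ^ ec) (½ ^ t))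
      0 (exponent v)
    where
    exponent : ∀ v → 10 ℕ.* v ℕ.+ 26 ≡ 2 ℕ.+ (6 ℕ.* v ℕ.+ 10 ℕ.+ (10 ℕ.+ ((v ℕ.+ v) ℕ.+ (v ℕ.+ v)))) ℕ.+ (0 ℕ.+ 4)
    exponent = solve-∀
  d≤ : 2ℚ ^ ed * (2ℚ * (½ ^ t′ + ½ ^ t′)) ≤ 1/12
  d≤ = cancel-powers (2 ℕ.+ ed) t′
      (solve 2 (λ A h → A :* (con 2ℚ :* (h :+ h)) := con 2ℚ :* (con 2ℚ :* A) :* h) refl (2ℚ ^ ed) (½ ^ t′))
      0 (exponent v)
    where
    exponent : ∀ v → 2 ℕ.* v ℕ.+ 14 ≡ 2 ℕ.+ (8 ℕ.+ (v ℕ.+ v)) ℕ.+ (0 ℕ.+ 4)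
    exponent = solve-∀

^-*-distrib : ∀ a b n → (a ℕ.* b) ℕ.^ n ≡ a ℕ.^ n ℕ.* b ℕ.^ n
^-*-distrib a b zero    = refl
^-*-distrib a b (suc n) = trans (cong (a ℕ.* b ℕ.*_) (^-*-distrib a b n)) (lem a b (a ℕ.^ n) (b ℕ.^ n))
  where
  lem : ∀ a b x y → a ℕ.* b ℕ.* (x ℕ.* y) ≡ a ℕ.* x ℕ.* (b ℕ.* y)
  lem = solve-∀

cost-powers : ∀ s t o i → o ℕ.+ i ℕ.≤ s ℕ.+ t →
  2 ℕ.^ s ℕ.* (2 ℕ.^ t ℕ.* 3 ℕ.+ 0) ℕ.+ (2 ℕ.^ o ℕ.* (2 ℕ.^ i ℕ.* 1 ℕ.+ 0) ℕ.+ 0) ℕ.≤ 2 ℕ.^ (2 ℕ.+ (s ℕ.+ t))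
cost-powers s t o i le = ℕₚ.≤-trans (ℕₚ.≤-reflexive (trans (lem (2 ℕ.^ s) (2 ℕ.^ t) (2 ℕ.^ o) (2 ℕ.^ i))
    (cong₂ (λ x y → 3 ℕ.* x ℕ.+ y) (sym (ℕₚ.^-distribˡ-+-* 2 s t)) (sym (ℕₚ.^-distribˡ-+-* 2 o i)))))
  (ℕₚ.≤-trans (ℕₚ.+-monoʳ-≤ (3 ℕ.* 2 ℕ.^ (s ℕ.+ t)) (ℕₚ.^-monoʳ-≤ 2 le)) (ℕₚ.≤-reflexive (lem′ (2 ℕ.^ (s ℕ.+ t)))))
  where
  lem : ∀ a b c d → a ℕ.* (b ℕ.* 3 ℕ.+ 0) ℕ.+ (c ℕ.* (d ℕ.* 1 ℕ.+ 0) ℕ.+ 0) ≡ 3 ℕ.* (a ℕ.* b) ℕ.+ c ℕ.* d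
  lem = solve-∀
  lem′ : ∀ x → 3 ℕ.* x ℕ.+ x ≡ 2 ℕ.* (2 ℕ.* x)
  lem′ = solve-∀

2^lg≤2* : ∀ u → 1 ℕ.≤ u → 2 ℕ.^ lg u ℕ.≤ 2 ℕ.* u
2^lg≤2* (suc u) _ = 2^lg≤-suc u

-- stated for variable exponents, since Agda would otherwise unfold 2 ^ 38 to a term of exponential size
2^-bound : ∀ w v u a d → w ≡ a ℕ.+ v ℕ.* d → 2 ℕ.^ v ℕ.≤ 2 ℕ.* u → 2 ℕ.^ w ℕ.≤ (2 ℕ.^ a ℕ.* 2 ℕ.^ d) ℕ.* u ℕ.^ d
2^-bound w v u a d refl h = ℕₚ.≤-trans
  (ℕₚ.≤-reflexive (trans (ℕₚ.^-distribˡ-+-* 2 a (v ℕ.* d)) (cong (2 ℕ.^ a ℕ.*_) (sym (ℕₚ.^-*-assoc 2 v d)))))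
  (ℕₚ.≤-trans (ℕₚ.*-monoʳ-≤ (2 ℕ.^ a) (ℕₚ.≤-trans (ℕₚ.^-monoˡ-≤ d h) (ℕₚ.≤-reflexive (^-*-distrib 2 u d))))
    (ℕₚ.≤-reflexive (sym (ℕₚ.*-assoc (2 ℕ.^ a) (2 ℕ.^ d) (u ℕ.^ d)))))

-- Buckets times influence samples dominate, giving 2^(38 + 16v) queries; 2^v is at most twice the
-- scale, hence degree 16.
queries-algorithmPos : ∀ n k ε .{{_ : Positive ε}} →
  queries (algorithmPos n k ε) ℕ.≤ (2 ℕ.^ 38 ℕ.* 2 ℕ.^ 16) ℕ.* (suc k ℕ.* ceiling-1/ ε) ℕ.^ 16
queries-algorithmPos n k ε = queries-flips seed _ _ λ ω → ℕₚ.≤-trans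
    (ℕₚ.≤-reflexive (queries-toAlg (estimateQ θ (13/16 * ε) ω)))
  (ℕₚ.≤-trans (cost-estimateQ θ (13/16 * ε) ω) (ℕₚ.≤-trans (cost-powers s t t′ t′ (le v))
      (2^-bound _ v u 38 16 (exponent v) (2^lg≤2* u 1≤u))))
  where
  open Threshold (threshold k ε)
  v  = scaleBits k ε
  open Procedure n (sizes noise v)
  θ  = 35/32 * τ
  u  = suc k ℕ.* ceiling-1/ ε
  s  = 6 ℕ.* v ℕ.+ 10
  t  = 10 ℕ.* v ℕ.+ 26
  t′ = 2 ℕ.* v ℕ.+ 14
  1≤u : 1 ℕ.≤ u
  1≤u = ℕₚ.≤-trans (ceiling-pos k ε) (ℕₚ.m≤m+n (ceiling-1/ ε) (k ℕ.* ceiling-1/ ε))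
  le : ∀ v → (2 ℕ.* v ℕ.+ 14) ℕ.+ (2 ℕ.* v ℕ.+ 14) ℕ.≤ (6 ℕ.* v ℕ.+ 10) ℕ.+ (10 ℕ.* v ℕ.+ 26)
  le v = ℕₚ.≤-trans (ℕₚ.m≤m+n _ (12 ℕ.* v ℕ.+ 8)) (ℕₚ.≤-reflexive (lem v))
    where
    lem : ∀ v → (2 ℕ.* v ℕ.+ 14) ℕ.+ (2 ℕ.* v ℕ.+ 14) ℕ.+ (12 ℕ.* v ℕ.+ 8) ≡ (6 ℕ.* v ℕ.+ 10) ℕ.+ (10 ℕ.* v ℕ.+ 26)
    lem = solve-∀
  exponent : ∀ v → 2 ℕ.+ ((6 ℕ.* v ℕ.+ 10) ℕ.+ (10 ℕ.* v ℕ.+ 26)) ≡ 38 ℕ.+ v ℕ.* 16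
  exponent = solve-∀

-- An `Algorithm` accepts every rational, so positivity is recovered from the numerator; for
-- nonpositive ε nothing is promised and the output is a default.
algorithm : Algorithm
algorithm n k ε@(mkℚ ℤ.+[1+ _ ] _ _) = algorithmPos n k ε
algorithm n k (mkℚ (ℤ.+ zero) _ _)   = out 0ℚ
algorithm n k (mkℚ ℤ.-[1+ _ ] _ _)   = out 0ℚ

theorem1p5 : Σ Algorithm λ A → PolyQueries A ×
    ((n k : ℕ) (ε : ℚ) .{{_ : Positive ε}} (f : BoolFn n) →
    PrAtLeast f (GoodEstimate n k ε f) (A n k ε) twoThirds)
theorem1p5 = algorithm , (2 ℕ.^ 38 ℕ.* 2 ℕ.^ 16 , 16 , poly) , correct
  where
  poly : (n k : ℕ) (ε : ℚ) .{{p : Positive ε}} →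
         queries (algorithm n k ε) ℕ.≤ (2 ℕ.^ 38 ℕ.* 2 ℕ.^ 16) ℕ.* (suc k ℕ.* ceiling-1/ ε) ℕ.^ 16
  poly n k ε@(mkℚ ℤ.+[1+ _ ] _ _) = queries-algorithmPos n k ε
  correct : (n k : ℕ) (ε : ℚ) .{{_ : Positive ε}} (f : BoolFn n) →
            PrAtLeast f (GoodEstimate n k ε f) (algorithm n k ε) twoThirds
  correct n k ε@(mkℚ ℤ.+[1+ _ ] _ _) f = algorithmPos-correct n k ε f
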